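{- For all integers $n\geq 0$, $c_{4}(n)\equiv 1 \pmod 2$ if $n=(7j^{2}+3j)/2$ for some $j\in\mathbb{Z}$, and $c_{4}(n)\equiv 0 \pmod 2$ otherwise.
   Context: A partition of $n$ is a finite non-increasing sequence of positive integers (its parts) summing to $n$. Let $c_{4}(n)$ be the number of partitions of $n$ in which either (a) all parts are even and distinct, or (b) there is an integer $j\ge1$ such that the even part $2j$ appears exactly twice, every positive even integer less than $2j$ appears exactly twice, every even part larger than $2j$ is at least $4j+2$ and appears at most once, and the odd parts are distinct and at most $2j-1$. -}

module Defs where

open import Data.Nat using (ℕ; zero; suc; _+_; _*_; _≤_; _<_; _>_; _≟_)
open import Data.Nat.Divisibility using (_∣_)
open import Data.List using (List; []; _∷_)
open import Data.Nat.ListAction using (sum)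
open import Data.Sum using (_⊎_)
open import Data.List.Membership.Propositional using (_∈_)
open import Data.List.Relation.Unary.All using (All)
open import Data.List.Relation.Unary.Linked using (Linked)
open import Data.List.Relation.Unary.Unique.Propositional using (Unique)
open import Data.Product using (_×_; Σ; ∃-syntax)
open import Relation.Nullary using (¬_; yes; no)
open import Relation.Binary.PropositionalEquality using (_≡_)

Even : ℕ → Set
Even x = 2 ∣ x

Odd : ℕ → Set
Odd x = ¬ (2 ∣ x)

IsPartition : ℕ → List ℕ → Set
IsPartition n p = All (λ x → 0 < x) p × Linked (λ a b → b ≤ a) p × sum p ≡ n

mult : ℕ → List ℕ → ℕ
mult x [] = 0
mult x (y ∷ p) with x ≟ y
... | yes _ = suc (mult x p)
... | no  _ = mult x p

CondA : List ℕ → Set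
CondA p = All Even p × Unique p

CondBj : ℕ → List ℕ → Set
CondBj j p =
  1 ≤ j
  × mult (2 * j) p ≡ 2
  × (∀ i → 1 ≤ i → i < j → mult (2 * i) p ≡ 2)
  × (∀ e → e ∈ p → Even e → e > 2 * j → (4 * j + 2 ≤ e × mult e p ≤ 1))
  × (∀ o → o ∈ p → Odd o → (mult o p ≤ 1 × o + 1 ≤ 2 * j))

CondB : List ℕ → Set
CondB p = ∃[ j ] CondBj j p

C4 : List ℕ → Set
C4 p = CondA p ⊎ CondB p

module Submission where

-- The generating function of these partitions is
--   Σ_j q^(2j(j+1)) (-q;q²)_j (-q^(4j+2);q²)_∞,
-- with case (a) as the term j = 0.  Modulo 2 it is the Rogers–Selberg sum
--   (q²;q²)_∞ Σ_n q^(2n(n+1)) (q;q²)_n / (q²;q²)_{2n}.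
-- Following Bailey, expand
--   (q;q²)_n / (q²;q²)_{2n} = Σ_r α_r / ((q²;q²)_{n-r} (q²;q²)_{n+r+1}),
--   α_r = q^(r(3r-1)/2) (1 + q^(4r+2)),
-- exchange the sums, and evaluate the inner one by the Durfee rectangle identity
--   Σ_m q^(2m(m+s)) / ((q²;q²)_m (q²;q²)_{m+s}) = 1 / (q²;q²)_∞.
-- What is left is Σ_r α_r q^(2r(r+1)), where r contributes the exponents
-- (7j² + 3j)/2 for j = r and j = -r-1.  Working modulo q^T makes every sum and
-- product finite and 1 + q^k invertible for k > 0.

open import Defs
open import Level using (0ℓ)
open import Algebra.Bundles using (CommutativeRing)
import Algebra.Properties.Semiring.Exp
import Algebra.Solver.Ring
open import Algebra.Solver.Ring.AlmostCommutativeRing using (fromCommutativeRing; _-Raw-AlmostCommutative⟶_)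
open import Data.Bool using (Bool; true; false; _xor_; not)
import Data.Bool.Properties as 𝔹
open import Data.Maybe using (Maybe; just; nothing)
open import Data.Nat as ℕ using (ℕ; zero; suc; z≤n; s≤s)
import Data.Nat.Properties as ℕₚ
open import Data.Nat.Divisibility using (_∣_; divides; ∣m+n∣m⇒∣n)
open import Data.Nat.Solver using (module +-*-Solver)
open import Data.List using (List; []; _∷_)
open import Relation.Nullary using (yes; no)
open import Relation.Binary.PropositionalEquality as ≡ using (_≡_)

-- Conditions (a) and (b) prescribe the allowed multiplicities of each part size separately, and the
-- partition determines j. So the partitions fall into disjoint blocks, and the generating function
-- of a block is a product with one factor per size. The Rogers-Selberg shape appears because signs
-- vanish modulo 2: (-q;q²)_j becomes (q;q²)_j, and (-q^(4j+2);q²)_∞ becomes (q²;q²)_∞ /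
-- (q²;q²)_{2j}. The obstacle is the expansion of (q;q²)_n / (q²;q²)_{2n}, a sum that does not
-- collapse term by term. Both sides are 1 at n = 0 and the quotient obeys a first-order recurrence
-- in n; that the sum obeys it too follows by creative telescoping in r, which leaves only
-- polynomial identities. The Durfee identity is proved by telescoping as well, without a bijection:
-- the sums for s and s+1 differ by a multiple of q^T, and for s ≥ T only the term m = 0 survives.

module PartitionLists where

  open import Data.Nat using (ℕ; zero; suc; _+_; _*_; _≤_; _<_; _>_; z≤n; s≤s; _≟_; _≤?_)
  open import Data.Nat.Properties
  open import Data.Nat.Divisibility using (_∣?_; divides)
  open import Data.Nat.ListAction using (sum)
  open import Data.List using (List; []; _∷_; _++_; map; replicate; filter)
  open import Data.List.Properties using (++-cancelˡ)
  open import Data.List.Membership.Propositional using (_∈_)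
  open import Data.List.Membership.Propositional.Properties using (∈-++⁻; ∈-++⁺ˡ; ∈-++⁺ʳ; ∈-map⁻; ∈-map⁺; ∈-filter⁺; ∈-filter⁻)
  open import Data.List.Relation.Unary.Any using (here; there)
  open import Data.List.Relation.Unary.All as All using (All; []; _∷_)
  import Data.List.Relation.Unary.All.Properties as Allₚ
  open import Data.List.Relation.Unary.AllPairs using ([]; _∷_)
  open import Data.List.Relation.Unary.Linked as Linked using (Linked; []; [-]; _∷_)
  open import Data.List.Relation.Unary.Linked.Properties using (Linked⇒AllPairs)
  open import Data.List.Relation.Unary.Unique.Propositional using (Unique)
  import Data.List.Relation.Unary.Unique.Propositional.Properties as Uniqueₚ
  open import Data.Product using (_×_; _,_; proj₁; proj₂; ∃; ∃-syntax)
  open import Data.Sum using (_⊎_; inj₁; inj₂)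
  open import Function using (_∘_)
  open import Function.Bundles using (_⇔_; mk⇔)
  open import Relation.Nullary.Decidable using (toSum)
  open import Relation.Nullary using (¬_; yes; no; contradiction)
  open import Relation.Binary.PropositionalEquality using (_≡_; _≢_; refl; sym; trans; cong; subst)

  -- Multiplicities and sorted lists

  mult-≡ : ∀ x p → mult x (x ∷ p) ≡ suc (mult x p)
  mult-≡ x p with x ≟ x
  ... | yes _ = refl
  ... | no x≢x = contradiction refl x≢x

  mult-≢ : ∀ {x y} p → x ≢ y → mult x (y ∷ p) ≡ mult x p
  mult-≢ {x} {y} p x≢y with x ≟ y
  ... | yes x≡y = contradiction x≡y x≢y
  ... | no _ = refl

  mult-∉ : ∀ {x p} → All (x ≢_) p → mult x p ≡ 0
  mult-∉ []             = refl
  mult-∉ (x≢y ∷ x∉p) = trans (mult-≢ _ x≢y) (mult-∉ x∉p)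

  mult-bounded : ∀ {x N p} → N < x → All (_≤ N) p → mult x p ≡ 0
  mult-bounded N<x = mult-∉ ∘ All.map λ y≤N → >⇒≢ (≤-<-trans y≤N N<x)

  mult-replicate-++ : ∀ m x p → mult x (replicate m x ++ p) ≡ m + mult x p
  mult-replicate-++ zero    x p = refl
  mult-replicate-++ (suc m) x p = trans (mult-≡ x _) (cong suc (mult-replicate-++ m x p))

  mult-replicate-++-≢ : ∀ m {x y} p → y ≢ x → mult y (replicate m x ++ p) ≡ mult y p
  mult-replicate-++-≢ zero    p y≢x = refl
  mult-replicate-++-≢ (suc m) p y≢x = trans (mult-≢ _ y≢x) (mult-replicate-++-≢ m p y≢x)

  ∈⇒mult>0 : ∀ {x p} → x ∈ p → 0 < mult x p
  ∈⇒mult>0 {x} {y ∷ p} x∈ with x ≟ y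
  ... | yes _ = s≤s z≤n
  ∈⇒mult>0 (here x≡y)  | no x≢y = contradiction x≡y x≢y
  ∈⇒mult>0 (there x∈p) | no _ = ∈⇒mult>0 x∈p

  mult>0⇒∈ : ∀ {x} p → 0 < mult x p → x ∈ p
  mult>0⇒∈ {x} (y ∷ p) 0< with x ≟ y
  ... | yes x≡y = here x≡y
  ... | no _ = there (mult>0⇒∈ p 0<)

  Unique⇒mult≤1 : ∀ {p} x → Unique p → mult x p ≤ 1
  Unique⇒mult≤1 x [] = z≤n
  Unique⇒mult≤1 {y ∷ p} x (y∉p ∷ p!) with x ≟ y
  ... | yes refl = s≤s (≤-reflexive (mult-∉ y∉p))
  ... | no _ = Unique⇒mult≤1 x p!

  mult≤1⇒Unique : ∀ p → (∀ x → x ∈ p → mult x p ≤ 1) → Unique p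
  mult≤1⇒Unique []      _  = []
  mult≤1⇒Unique (y ∷ p) ≤1 = Allₚ.¬Any⇒All¬ p y∉p ∷ mult≤1⇒Unique p λ x x∈p → ≤-trans (mult-∷ x) (≤1 x (there x∈p))
    where
    y∉p : ¬ y ∈ p
    y∉p y∈p = <⇒≱ (∈⇒mult>0 y∈p) (≤-pred (subst (_≤ 1) (mult-≡ y p) (≤1 y (here refl))))
    mult-∷ : ∀ x → mult x p ≤ mult x (y ∷ p)
    mult-∷ x with x ≟ y
    ... | yes _ = n≤1+n _
    ... | no _ = ≤-refl

  Sorted : List ℕ → Set
  Sorted = Linked (λ a b → b ≤ a)

  Sorted-head : ∀ {y p} → Sorted (y ∷ p) → All (_≤ y) p
  Sorted-head sorted with Linked⇒AllPairs (λ b≤a c≤b → ≤-trans c≤b b≤a) sorted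
  ... | y≥p ∷ _ = y≥p

  Sorted-∷ : ∀ {y p} → All (_≤ y) p → Sorted p → Sorted (y ∷ p)
  Sorted-∷ []          []     = [-]
  Sorted-∷ (z≤y ∷ _) sorted = z≤y ∷ sorted

  record Bounded (N : ℕ) (p : List ℕ) : Set where
    constructor bounded
    field
      sorted   : Sorted p
      positive : All (0 <_) p
      ≤bound   : All (_≤ N) p

  Bounded-replicate-++ : ∀ m {N p} → Bounded N p → Bounded (suc N) (replicate m (suc N) ++ p)
  Bounded-replicate-++ zero    (bounded s 0< ≤N) = bounded s 0< (All.map m≤n⇒m≤1+n ≤N)
  Bounded-replicate-++ (suc m) b with Bounded-replicate-++ m b
  ... | bounded s 0< ≤N = bounded (Sorted-∷ ≤N s) (s≤s z≤n ∷ 0<) (≤-refl ∷ ≤N)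

  -- In a non-increasing list the copies of the largest admissible size stand in front: once the
  -- head differs from `suc N`, everything is at most `N`.
  peel : ∀ {N} p → Bounded (suc N) p → ∃ λ p′ → p ≡ replicate (mult (suc N) p) (suc N) ++ p′ × Bounded N p′
  peel [] _ = [] , refl , bounded [] [] []
  peel {N} (y ∷ p) (bounded s (0<y ∷ 0<) (y≤ ∷ ≤N)) with suc N ≟ y
  ... | yes refl with peel p (bounded (Linked.tail s) 0< ≤N)
  ...   | p′ , eq , b = p′ , cong (suc N ∷_) eq , b
  peel {N} (y ∷ p) (bounded s (0<y ∷ 0<) (y≤ ∷ ≤N)) | no N≢y =
    y ∷ p , cong (λ m → replicate m (suc N) ++ y ∷ p) (sym (mult-bounded (n<1+n N) p≤N)) , bounded s (0<y ∷ 0<) (y≤N ∷ p≤N)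
    where
    y≤N : y ≤ N
    y≤N = ≤-pred (≤∧≢⇒< y≤ (N≢y ∘ sym))
    p≤N : All (_≤ N) p
    p≤N = All.map (λ z≤y → ≤-trans z≤y y≤N) (Sorted-head s)

  addParts : ℕ → List ℕ → List (List ℕ) → List (List ℕ)
  addParts x []       P = []
  addParts x (m ∷ ms) P = map (replicate m x ++_) P ++ addParts x ms P

  ∈-addParts⁻ : ∀ x ms {P p} → p ∈ addParts x ms P → ∃[ m ] ∃[ p′ ] (m ∈ ms × p′ ∈ P × p ≡ replicate m x ++ p′)
  ∈-addParts⁻ x (m ∷ ms) {P} p∈ with ∈-++⁻ (map (replicate m x ++_) P) p∈
  ... | inj₁ p∈map with ∈-map⁻ _ p∈map
  ...   | p′ , p′∈P , eq = m , p′ , here refl , p′∈P , eq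
  ∈-addParts⁻ x (m ∷ ms) {P} p∈ | inj₂ p∈rest with ∈-addParts⁻ x ms p∈rest
  ...   | m′ , p′ , m′∈ , p′∈P , eq = m′ , p′ , there m′∈ , p′∈P , eq

  ∈-addParts⁺ : ∀ x {ms P m p′} → m ∈ ms → p′ ∈ P → replicate m x ++ p′ ∈ addParts x ms P
  ∈-addParts⁺ x (here refl) p′∈P = ∈-++⁺ˡ (∈-map⁺ _ p′∈P)
  ∈-addParts⁺ x (there m∈)  p′∈P = ∈-++⁺ʳ _ (∈-addParts⁺ x m∈ p′∈P)

  -- Since no list of `P` contains `x`, the multiplicity of `x` in a result recovers the `m` that
  -- was chosen.
  Unique-addParts : ∀ x {ms P} → (∀ {p} → p ∈ P → mult x p ≡ 0) → Unique ms → Unique P → Unique (addParts x ms P)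
  Unique-addParts x P≢ [] P! = []
  Unique-addParts x {m ∷ ms} P≢ (m∉ ∷ ms!) P! =
    Uniqueₚ.++⁺ (Uniqueₚ.map⁺ (λ {p} {p′} → ++-cancelˡ (replicate m x) p p′) P!) (Unique-addParts x P≢ ms! P!) disjoint
    where
    mult≡ : ∀ m {p} p′ → p′ ∈ _ → p ≡ replicate m x ++ p′ → mult x p ≡ m
    mult≡ m p′ p′∈ refl = trans (mult-replicate-++ m x p′) (trans (cong (m +_) (P≢ p′∈)) (+-identityʳ m))
    disjoint : ∀ {p} → ¬ (p ∈ map (replicate m x ++_) _ × p ∈ addParts x ms _)
    disjoint (p∈map , p∈rest) with ∈-map⁻ _ p∈map | ∈-addParts⁻ x ms p∈rest
    ... | p₁ , p₁∈ , eq₁ | m′ , p₂ , m′∈ , p₂∈ , eq₂ =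
      All.lookup m∉ m′∈ (trans (sym (mult≡ m p₁ p₁∈ eq₁)) (mult≡ m′ p₂ p₂∈ eq₂))

  -- Partitions with prescribed multiplicities

  module _ (ms : ℕ → List ℕ) where

    -- Sizes enter in increasing order, each in front of the smaller ones, so the lists come out
    -- sorted and each size contributes one factor to the generating function.
    partitions : ℕ → List (List ℕ)
    partitions zero    = [] ∷ []
    partitions (suc N) = addParts (suc N) (ms (suc N)) (partitions N)

    Respects : ℕ → List ℕ → Set
    Respects N p = ∀ x → 0 < x → x ≤ N → mult x p ∈ ms x

    partitions-sound : ∀ N {p} → p ∈ partitions N → Bounded N p × Respects N p
    partitions-sound zero (here refl) = bounded [] [] [] , λ { _ (s≤s _) () }
    partitions-sound (suc N) p∈ with ∈-addParts⁻ (suc N) (ms (suc N)) p∈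
    ... | m , p′ , m∈ , p′∈ , refl with partitions-sound N p′∈
    ... | b , r = Bounded-replicate-++ m b , respects
      where
      respects : Respects (suc N) (replicate m (suc N) ++ p′)
      respects x 0<x x≤ with x ≟ suc N
      ... | yes refl = subst (_∈ ms (suc N)) (sym (trans (mult-replicate-++ m x p′)
                         (trans (cong (m +_) (mult-bounded (n<1+n N) (Bounded.≤bound b))) (+-identityʳ m)))) m∈
      ... | no x≢ = subst (_∈ ms x) (sym (mult-replicate-++-≢ m p′ x≢)) (r x 0<x (≤-pred (≤∧≢⇒< x≤ x≢)))

    partitions-complete : ∀ N {p} → Bounded N p → Respects N p → p ∈ partitions N
    partitions-complete zero {[]} _ _ = here refl
    partitions-complete zero {_ ∷ _} (bounded _ (() ∷ _) (z≤n ∷ _)) _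
    partitions-complete (suc N) {p} b r with peel p b
    ... | p′ , eq , b′ = subst (_∈ _) (sym eq) (∈-addParts⁺ (suc N) (r (suc N) (s≤s z≤n) ≤-refl)
      (partitions-complete N b′ λ x 0<x x≤N → subst (_∈ ms x)
        (trans (cong (mult x) eq) (mult-replicate-++-≢ (mult (suc N) p) p′ (<⇒≢ (s≤s x≤N)))) (r x 0<x (m≤n⇒m≤1+n x≤N))))

    Unique-partitions : (∀ x → Unique (ms x)) → ∀ N → Unique (partitions N)
    Unique-partitions ms! zero    = [] ∷ []
    Unique-partitions ms! (suc N) = Unique-addParts (suc N)
      (λ p∈ → mult-bounded (n<1+n N) (Bounded.≤bound (proj₁ (partitions-sound N p∈)))) (ms! (suc N)) (Unique-partitions ms! N)

  -- One table for both conditions. For `j = 0` every positive size exceeds `2 * j` and `4 * j`, so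
  -- even sizes may occur at most once and odd sizes not at all, which is case (a).
  multiplicities : ℕ → ℕ → List ℕ
  multiplicities j x with 2 ∣? x | x ≤? 2 * j | x ≤? 4 * j
  ... | yes _ | yes _ | _     = 2 ∷ []
  ... | yes _ | no _  | yes _ = 0 ∷ []
  ... | yes _ | no _  | no _  = 0 ∷ 1 ∷ []
  ... | no _  | yes _ | _     = 0 ∷ 1 ∷ []
  ... | no _  | no _  | _     = 0 ∷ []

  Unique-multiplicities : ∀ j x → Unique (multiplicities j x)
  Unique-multiplicities j x with 2 ∣? x | x ≤? 2 * j | x ≤? 4 * j
  ... | yes _ | yes _ | _     = [] ∷ []
  ... | yes _ | no _  | yes _ = [] ∷ []
  ... | yes _ | no _  | no _  = ((λ ()) ∷ []) ∷ [] ∷ []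
  ... | no _  | yes _ | _     = ((λ ()) ∷ []) ∷ [] ∷ []
  ... | no _  | no _  | _     = [] ∷ []

  module _ {j x : ℕ} where

    multiplicities-smallEven : Even x → x ≤ 2 * j → multiplicities j x ≡ 2 ∷ []
    multiplicities-smallEven even x≤2j with 2 ∣? x | x ≤? 2 * j | x ≤? 4 * j
    ... | yes _ | yes _   | _ = refl
    ... | yes _ | no x≰2j | _ = contradiction x≤2j x≰2j
    ... | no odd | _      | _ = contradiction even odd

    multiplicities-middleEven : Even x → 2 * j < x → x ≤ 4 * j → multiplicities j x ≡ 0 ∷ []
    multiplicities-middleEven even 2j<x x≤4j with 2 ∣? x | x ≤? 2 * j | x ≤? 4 * j
    ... | yes _ | yes x≤2j | _      = contradiction x≤2j (<⇒≱ 2j<x)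
    ... | yes _ | no _ | yes _      = refl
    ... | yes _ | no _ | no x≰4j    = contradiction x≤4j x≰4j
    ... | no odd | _      | _ = contradiction even odd

    multiplicities-largeEven : Even x → 4 * j < x → multiplicities j x ≡ 0 ∷ 1 ∷ []
    multiplicities-largeEven even 4j<x with 2 ∣? x | x ≤? 2 * j | x ≤? 4 * j
    ... | yes _ | yes x≤2j | _      = contradiction (≤-trans x≤2j (*-monoˡ-≤ j (s≤s (s≤s (z≤n {2}))))) (<⇒≱ 4j<x)
    ... | yes _ | no _ | yes x≤4j   = contradiction x≤4j (<⇒≱ 4j<x)
    ... | yes _ | no _ | no x≰4j    = refl
    ... | no odd | _      | _ = contradiction even odd

    multiplicities-smallOdd : Odd x → x ≤ 2 * j → multiplicities j x ≡ 0 ∷ 1 ∷ []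
    multiplicities-smallOdd odd x≤2j with 2 ∣? x | x ≤? 2 * j | x ≤? 4 * j
    ... | yes even | _   | _ = contradiction even odd
    ... | no _ | yes _   | _ = refl
    ... | no _ | no x≰2j | _ = contradiction x≤2j x≰2j

    multiplicities-largeOdd : Odd x → 2 * j < x → multiplicities j x ≡ 0 ∷ []
    multiplicities-largeOdd odd 2j<x with 2 ∣? x | x ≤? 2 * j | x ≤? 4 * j
    ... | yes even | _   | _ = contradiction even odd
    ... | no _ | yes x≤2j | _ = contradiction x≤2j (<⇒≱ 2j<x)
    ... | no _ | no _     | _ = refl

  ∈-respʳ-≡ : ∀ {m} {l l′ : List ℕ} → l ≡ l′ → m ∈ l → m ∈ l′
  ∈-respʳ-≡ refl m∈ = m∈

  ∈01⇒≤1 : ∀ {m} → m ∈ 0 ∷ 1 ∷ [] → m ≤ 1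
  ∈01⇒≤1 (here refl)         = z≤n
  ∈01⇒≤1 (there (here refl)) = ≤-refl

  ≤1⇒∈01 : ∀ {m} → m ≤ 1 → m ∈ 0 ∷ 1 ∷ []
  ≤1⇒∈01 z≤n       = here refl
  ≤1⇒∈01 (s≤s z≤n) = there (here refl)

  ∈[]⇒≡ : ∀ {m k : ℕ} → m ∈ k ∷ [] → m ≡ k
  ∈[]⇒≡ (here eq) = eq

  AllRespects : ℕ → List ℕ → Set
  AllRespects j p = ∀ x → 0 < x → mult x p ∈ multiplicities j x

  ∈⇒mult≢0 : ∀ {x p} → x ∈ p → mult x p ≢ 0
  ∈⇒mult≢0 x∈p eq = <⇒≢ (∈⇒mult>0 x∈p) (sym eq)

  mult≡0-or-∈ : ∀ x p → mult x p ≡ 0 ⊎ x ∈ p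
  mult≡0-or-∈ x p with mult x p in eq
  ... | zero  = inj₁ refl
  ... | suc _ = inj₂ (mult>0⇒∈ p (subst (0 <_) (sym eq) (s≤s z≤n)))

  Even-2* : ∀ i → Even (2 * i)
  Even-2* i = divides i (*-comm 2 i)

  4*≡2** : ∀ j → 4 * j ≡ 2 * (2 * j)
  4*≡2** j = *-assoc 2 2 j

  -- Compare halves: with e = 2k, the hypothesis gives 2j < k, hence 2j + 1 ≤ k.
  even-gap : ∀ {e} j → Even e → 4 * j < e → 4 * j + 2 ≤ e
  even-gap j (divides k refl) 4j<e = begin
    4 * j + 2          ≡⟨ cong (_+ 2) (trans (4*≡2** j) (*-comm 2 (2 * j))) ⟩
    2 * j * 2 + 2      ≡⟨ +-comm (2 * j * 2) 2 ⟩
    suc (2 * j) * 2    ≤⟨ *-monoˡ-≤ 2 (*-cancelʳ-< 2 (2 * j) k (subst (_< k * 2) (trans (4*≡2** j) (*-comm 2 (2 * j))) 4j<e)) ⟩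
    k * 2              ∎
    where open ≤-Reasoning

  -- Equivalence of the table with conditions (a) and (b)

  AllRespects⇒CondA : ∀ {p} → All (0 <_) p → AllRespects 0 p → CondA p
  AllRespects⇒CondA {p} 0< r = All.tabulate even , mult≤1⇒Unique p λ x x∈ →
    ∈01⇒≤1 (∈-respʳ-≡ (multiplicities-largeEven {0} (even x∈) (All.lookup 0< x∈)) (r x (All.lookup 0< x∈)))
    where
    even : ∀ {x} → x ∈ p → Even x
    even {x} x∈ with 2 ∣? x
    ... | yes e = e
    ... | no o  = contradiction (∈[]⇒≡ (∈-respʳ-≡ (multiplicities-largeOdd {0} o (All.lookup 0< x∈)) (r x (All.lookup 0< x∈)))) (∈⇒mult≢0 x∈)

  AllRespects⇒CondBj : ∀ {j p} → 0 < j → All (0 <_) p → AllRespects j p → CondBj j p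
  AllRespects⇒CondBj {j} {p} 0<j 0< r = 0<j , twice j 0<j ≤-refl , (λ i 0<i i<j → twice i 0<i (<⇒≤ i<j)) , evens , odds
    where
    twice : ∀ i → 0 < i → i ≤ j → mult (2 * i) p ≡ 2
    twice i 0<i i≤j = ∈[]⇒≡ (∈-respʳ-≡ (multiplicities-smallEven (Even-2* i) (*-monoʳ-≤ 2 i≤j)) (r (2 * i) (≤-trans 0<i (m≤m+n i _))))
    evens : ∀ e → e ∈ p → Even e → e > 2 * j → 4 * j + 2 ≤ e × mult e p ≤ 1
    evens e e∈ even 2j<e with e ≤? 4 * j
    ... | yes e≤4j = contradiction (∈[]⇒≡ (∈-respʳ-≡ (multiplicities-middleEven even 2j<e e≤4j) (r e (All.lookup 0< e∈)))) (∈⇒mult≢0 e∈)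
    ... | no e≰4j  = even-gap j even (≰⇒> e≰4j) , ∈01⇒≤1 (∈-respʳ-≡ (multiplicities-largeEven even (≰⇒> e≰4j)) (r e (All.lookup 0< e∈)))
    odds : ∀ o → o ∈ p → Odd o → mult o p ≤ 1 × o + 1 ≤ 2 * j
    odds o o∈ odd with o ≤? 2 * j
    ... | yes o≤2j = ∈01⇒≤1 (∈-respʳ-≡ (multiplicities-smallOdd odd o≤2j) (r o (All.lookup 0< o∈))) ,
                     -- An odd part differs from 2j, so the bound 2j of the table sharpens to 2j -
                     -- 1.
                     subst (_≤ 2 * j) (+-comm 1 o) (≤∧≢⇒< o≤2j λ { refl → odd (Even-2* j) })
    ... | no o≰2j  = contradiction (∈[]⇒≡ (∈-respʳ-≡ (multiplicities-largeOdd odd (≰⇒> o≰2j)) (r o (All.lookup 0< o∈)))) (∈⇒mult≢0 o∈)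

  even⊎odd : ∀ x → Even x ⊎ Odd x
  even⊎odd x = toSum (2 ∣? x)

  CondA⇒AllRespects : ∀ {p} → CondA p → AllRespects 0 p
  CondA⇒AllRespects {p} (evens , p!) x 0<x with even⊎odd x
  ... | inj₁ even = ∈-respʳ-≡ (sym (multiplicities-largeEven {0} even 0<x)) (≤1⇒∈01 (Unique⇒mult≤1 x p!))
  ... | inj₂ odd  = ∈-respʳ-≡ (sym (multiplicities-largeOdd {0} odd 0<x)) (here (mult-∉ (All.map (λ { even refl → odd even }) evens)))

  CondBj⇒AllRespects : ∀ {j p} → CondBj j p → AllRespects j p
  CondBj⇒AllRespects {j} {p} (0<j , top , lower , evens , odds) x 0<x with even⊎odd x | ≤-<-connex x (2 * j)
  ... | inj₁ even | inj₁ x≤2j = ∈-respʳ-≡ (sym (multiplicities-smallEven even x≤2j)) (here (twice even 0<x x≤2j))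
    where
    twice : ∀ {x} → Even x → 0 < x → x ≤ 2 * j → mult x p ≡ 2
    twice (divides (suc k) refl) _ x≤2j rewrite *-comm (suc k) 2 with suc k ≟ j
    ... | yes refl = top
    ... | no k≢j   = lower (suc k) (s≤s z≤n) (≤∧≢⇒< (*-cancelˡ-≤ 2 x≤2j) k≢j)
  ... | inj₁ even | inj₂ 2j<x with ≤-<-connex x (4 * j) | mult≡0-or-∈ x p
  ...   | inj₁ x≤4j | inj₁ eq = ∈-respʳ-≡ (sym (multiplicities-middleEven even 2j<x x≤4j)) (here eq)
  -- An even part between 2j and 4j would have to be at least 4j + 2.
  ...   | inj₁ x≤4j | inj₂ x∈ = contradiction (≤-trans (proj₁ (evens x x∈ even 2j<x)) x≤4j) (<⇒≱ (m<m+n (4 * j) (s≤s z≤n)))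
  ...   | inj₂ 4j<x | inj₁ eq = ∈-respʳ-≡ (sym (multiplicities-largeEven even 4j<x)) (here eq)
  ...   | inj₂ 4j<x | inj₂ x∈ = ∈-respʳ-≡ (sym (multiplicities-largeEven even 4j<x)) (≤1⇒∈01 (proj₂ (evens x x∈ even 2j<x)))
  CondBj⇒AllRespects {j} {p} (0<j , top , lower , evens , odds) x 0<x | inj₂ odd | inj₁ x≤2j with mult≡0-or-∈ x p
  ... | inj₁ eq = ∈-respʳ-≡ (sym (multiplicities-smallOdd odd x≤2j)) (here eq)
  ... | inj₂ x∈ = ∈-respʳ-≡ (sym (multiplicities-smallOdd odd x≤2j)) (≤1⇒∈01 (proj₁ (odds x x∈ odd)))
  CondBj⇒AllRespects {j} {p} (0<j , top , lower , evens , odds) x 0<x | inj₂ odd | inj₂ 2j<x with mult≡0-or-∈ x p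
  ... | inj₁ eq = ∈-respʳ-≡ (sym (multiplicities-largeOdd odd 2j<x)) (here eq)
  ... | inj₂ x∈ = contradiction (≤-trans (m≤m+n x 1) (proj₂ (odds x x∈ odd))) (<⇒≱ 2j<x)

  -- The blocks and the list of all partitions counted

  module _ (n : ℕ) where

    -- Any bound ≥ n gives the same partitions of n; this one makes the generating
    -- function of block j equal to the j-th summand of the Rogers–Selberg sum.
    bound : ℕ → ℕ
    bound j = (j + j + suc n) * 2

    block : ℕ → List (List ℕ)
    block j = partitions (multiplicities j) (bound j)

    4j≤bound : ∀ j → 4 * j ≤ bound j
    4j≤bound j = subst (_≤ bound j) (trans (cong (λ k → (j + k) * 2) (sym (+-identityʳ j))) (trans (*-comm (2 * j) 2) (sym (4*≡2** j))))
      (*-monoˡ-≤ 2 (m≤m+n (j + j) (suc n)))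

    suc-n≤bound : ∀ j → suc n ≤ bound j
    suc-n≤bound j = ≤-trans (m≤n+m (suc n) (j + j)) (m≤m*n (j + j + suc n) 2)

    -- `partitions` constrains only sizes up to `bound j`. Larger sizes do not occur, and the table
    -- allows multiplicity 0 for them because they exceed 4j.
    block-AllRespects : ∀ j {p} → p ∈ block j → AllRespects j p
    block-AllRespects j {p} p∈ x 0<x with partitions-sound (multiplicities j) (bound j) p∈ | x ≤? bound j
    ... | b , r | yes x≤ = r x 0<x x≤
    ... | b , r | no x≰ = subst (_∈ multiplicities j x) (sym (mult-bounded (≰⇒> x≰) (Bounded.≤bound b))) 0∈
      where
      4j<x : 4 * j < x
      4j<x = ≤-<-trans (4j≤bound j) (≰⇒> x≰)
      0∈ : 0 ∈ multiplicities j x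
      0∈ with even⊎odd x
      ... | inj₁ even = subst (0 ∈_) (sym (multiplicities-largeEven even 4j<x)) (here refl)
      ... | inj₂ odd  = subst (0 ∈_) (sym (multiplicities-largeOdd odd (≤-<-trans (*-monoˡ-≤ j (s≤s (s≤s (z≤n {2})))) 4j<x))) (here refl)

    blocks : ℕ → List (List ℕ)
    blocks zero    = []
    blocks (suc k) = blocks k ++ block k

    ∈-blocks⁻ : ∀ k {p} → p ∈ blocks k → ∃[ j ] (j < k × p ∈ block j)
    ∈-blocks⁻ (suc k) p∈ with ∈-++⁻ (blocks k) p∈
    ... | inj₂ p∈block = k , ≤-refl , p∈block
    ... | inj₁ p∈blocks with ∈-blocks⁻ k p∈blocks
    ...   | j , j<k , p∈block = j , m<n⇒m<1+n j<k , p∈block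

    ∈-blocks⁺ : ∀ {k j p} → j < k → p ∈ block j → p ∈ blocks k
    ∈-blocks⁺ {suc k} {j} j<1+k p∈ with j ≟ k
    ... | yes refl = ∈-++⁺ʳ (blocks k) p∈
    ... | no j≢k   = ∈-++⁺ˡ (∈-blocks⁺ (≤∧≢⇒< (≤-pred j<1+k) j≢k) p∈)

    -- For i < j the multiplicity of 2j tells block i from block j.
    block-disjoint : ∀ {i j p} → i < j → p ∈ block i → ¬ p ∈ block j
    block-disjoint {i} {j} {p} i<j p∈i p∈j = <⇒≱ (s≤s (s≤s z≤n)) (subst (_≤ 1) two (mult≤1 (≤-<-connex (2 * j) (4 * i))))
      where
      0<2j : 0 < 2 * j
      0<2j = ≤-trans (≤-trans (s≤s z≤n) i<j) (m≤m+n j _)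
      two : mult (2 * j) p ≡ 2
      two = ∈[]⇒≡ (∈-respʳ-≡ (multiplicities-smallEven (Even-2* j) ≤-refl) (block-AllRespects j p∈j (2 * j) 0<2j))
      mult≤1 : 2 * j ≤ 4 * i ⊎ 4 * i < 2 * j → mult (2 * j) p ≤ 1
      mult≤1 (inj₁ 2j≤4i) = ≤-trans (≤-reflexive (∈[]⇒≡ (∈-respʳ-≡
        (multiplicities-middleEven (Even-2* j) (*-monoʳ-< 2 i<j) 2j≤4i) (block-AllRespects i p∈i (2 * j) 0<2j)))) z≤n
      mult≤1 (inj₂ 4i<2j) = ∈01⇒≤1 (∈-respʳ-≡
        (multiplicities-largeEven (Even-2* j) 4i<2j) (block-AllRespects i p∈i (2 * j) 0<2j))

    Unique-blocks : ∀ k → Unique (blocks k)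
    Unique-blocks zero    = []
    Unique-blocks (suc k) = Uniqueₚ.++⁺ (Unique-blocks k) (Unique-partitions _ (Unique-multiplicities k) (bound k))
      λ { (p∈blocks , p∈block) → let j , j<k , p∈j = ∈-blocks⁻ k p∈blocks in block-disjoint j<k p∈j p∈block }

    c4-partitions : List (List ℕ)
    c4-partitions = filter (λ p → sum p ≟ n) (blocks (suc n))

    ∈⇒≤sum : ∀ {x} p → x ∈ p → x ≤ sum p
    ∈⇒≤sum (y ∷ p) (here refl) = m≤m+n y (sum p)
    ∈⇒≤sum (y ∷ p) (there x∈)  = ≤-trans (∈⇒≤sum p x∈) (m≤n+m (sum p) y)

    block-C4 : ∀ j {p} → p ∈ block j → C4 p
    block-C4 j p∈ with partitions-sound (multiplicities j) (bound j) p∈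
    block-C4 zero    p∈ | b , _ = inj₁ (AllRespects⇒CondA (Bounded.positive b) (block-AllRespects 0 p∈))
    block-C4 (suc j) p∈ | b , _ = inj₂ (suc j , AllRespects⇒CondBj (s≤s z≤n) (Bounded.positive b) (block-AllRespects (suc j) p∈))

    ∈-block : ∀ {j p} → IsPartition n p → AllRespects j p → p ∈ block j
    ∈-block {j} {p} (0< , sorted , sum≡n) r = partitions-complete (multiplicities j) (bound j)
      (bounded sorted 0< (All.tabulate λ x∈ → ≤-trans (subst (_ ≤_) sum≡n (∈⇒≤sum p x∈)) (≤-trans (n≤1+n n) (suc-n≤bound j))))
      (λ x 0<x _ → r x 0<x)

    C4-block : ∀ {p} → IsPartition n p → C4 p → ∃[ j ] (j < suc n × p ∈ block j)
    C4-block isP (inj₁ a) = 0 , s≤s z≤n , ∈-block isP (CondA⇒AllRespects a)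
    C4-block {p} isP@(_ , _ , sum≡n) (inj₂ (j , b@(_ , two , _))) = j ,
      -- The size 2j is a part, so j ≤ 2j ≤ n; hence the blocks with j ≤ n suffice.
      s≤s (≤-trans (m≤m+n j _) (subst (2 * j ≤_) sum≡n (∈⇒≤sum p (mult>0⇒∈ p (subst (0 <_) (sym two) (s≤s z≤n)))))) ,
      ∈-block isP (CondBj⇒AllRespects b)

    Unique-c4-partitions : Unique c4-partitions
    Unique-c4-partitions = Uniqueₚ.filter⁺ _ (Unique-blocks (suc n))

    ∈-c4-partitions : ∀ p → p ∈ c4-partitions ⇔ (IsPartition n p × C4 p)
    ∈-c4-partitions p = mk⇔ to from
      where
      to : p ∈ c4-partitions → IsPartition n p × C4 p
      to p∈ with ∈-filter⁻ (λ p → sum p ≟ n) {xs = blocks (suc n)} p∈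
      ... | p∈blocks , sum≡n with ∈-blocks⁻ (suc n) p∈blocks
      ...   | j , _ , p∈block with partitions-sound (multiplicities j) (bound j) p∈block
      ...     | bounded sorted 0< _ , _ = (0< , sorted , sum≡n) , block-C4 j p∈block
      from : IsPartition n p × C4 p → p ∈ c4-partitions
      from (isP@(_ , _ , sum≡n) , c4) with C4-block isP c4
      ... | j , j<1+n , p∈block = ∈-filter⁺ (λ p → sum p ≟ n) (∈-blocks⁺ j<1+n p∈block) sum≡n

open PartitionLists

-- Commutative rings of characteristic 2

Characteristic-2 : CommutativeRing 0ℓ 0ℓ → Set
Characteristic-2 R = 1# + 1# ≈ 0#
  where open CommutativeRing R

PowerVanishes : (R : CommutativeRing 0ℓ 0ℓ) → CommutativeRing.Carrier R → ℕ → Set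
PowerVanishes R q k = q ^ k ≈ 0#
  where
  open CommutativeRing R
  open Algebra.Properties.Semiring.Exp semiring

module Characteristic2 (R : CommutativeRing 0ℓ 0ℓ) (1+1≈0 : Characteristic-2 R) where

  open CommutativeRing R
  open import Relation.Binary.Reasoning.Setoid setoid

  x+x≈0 : ∀ x → x + x ≈ 0#
  x+x≈0 x = begin
    x + x              ≈⟨ +-cong (*-identityˡ x) (*-identityˡ x) ⟨
    1# * x + 1# * x    ≈⟨ distribʳ x 1# 1# ⟨
    (1# + 1#) * x      ≈⟨ *-congʳ 1+1≈0 ⟩
    0# * x             ≈⟨ zeroˡ x ⟩
    0#                 ∎

  x+y≈0⇒x≈y : ∀ {x y} → x + y ≈ 0# → x ≈ y
  x+y≈0⇒x≈y {x} {y} eq = begin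
    x              ≈⟨ +-identityʳ x ⟨
    x + 0#         ≈⟨ +-congˡ (x+x≈0 y) ⟨
    x + (y + y)    ≈⟨ +-assoc x y y ⟨
    x + y + y      ≈⟨ +-congʳ eq ⟩
    0# + y         ≈⟨ +-identityˡ y ⟩
    y              ∎

  -x≈x : ∀ x → - x ≈ x
  -x≈x x = x+y≈0⇒x≈y (-‿inverseˡ x)

  fromBool : Bool → Carrier
  fromBool false = 0#
  fromBool true  = 1#

  -- Coefficients in 𝔽₂ make the solver cancel x + x.
  fromBool-morphism : CommutativeRing.rawRing 𝔹.xor-∧-commutativeRing -Raw-AlmostCommutative⟶ fromCommutativeRing R
  fromBool-morphism = record
    { ⟦_⟧    = fromBool
    ; +-homo = λ { false y → sym (+-identityˡ _)
                 ; true false → sym (+-identityʳ _)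
                 ; true true → sym 1+1≈0 }
    ; *-homo = λ { false y → sym (zeroˡ _)
                 ; true y → sym (*-identityˡ _) }
    ; -‿homo = λ x → sym (-x≈x (fromBool x))
    ; 0-homo = refl
    ; 1-homo = refl
    }

  fromBool-≟ : ∀ x y → Maybe (fromBool x ≈ fromBool y)
  fromBool-≟ x y with x 𝔹.≟ y
  ... | yes ≡.refl = just refl
  ... | no _ = nothing

  module Solver = Algebra.Solver.Ring (CommutativeRing.rawRing 𝔹.xor-∧-commutativeRing)
    (fromCommutativeRing R) fromBool-morphism fromBool-≟

-- The pentagonal numbers r(3r-1)/2, given by their increments so that nothing has to be halved.
pent : ℕ → ℕ
pent zero    = 0
pent (suc r) = pent r ℕ.+ suc (3 ℕ.* r)

pent-square : ∀ r → 2 ℕ.* pent r ℕ.+ r ≡ 3 ℕ.* (r ℕ.* r)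
pent-square zero    = ≡.refl
pent-square (suc r) = ≡.trans
  (solveℕ 2 (λ p r → conℕ 2 ⊗ (p ⊕ (conℕ 1 ⊕ conℕ 3 ⊗ r)) ⊕ (conℕ 1 ⊕ r) ⊜ conℕ 2 ⊗ p ⊕ r ⊕ (conℕ 3 ⊕ conℕ 6 ⊗ r)) ≡.refl (pent r) r)
  (≡.trans (≡.cong (ℕ._+ (3 ℕ.+ 6 ℕ.* r)) (pent-square r))
    (solveℕ 1 (λ r → conℕ 3 ⊗ (r ⊗ r) ⊕ (conℕ 3 ⊕ conℕ 6 ⊗ r) ⊜ conℕ 3 ⊗ ((conℕ 1 ⊕ r) ⊗ (conℕ 1 ⊕ r))) ≡.refl r))
  where open +-*-Solver using () renaming (solve to solveℕ; _:+_ to _⊕_; _:*_ to _⊗_; _:=_ to _⊜_; con to conℕ)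

-- (7j² + 3j)/2 at j = r and at j = -r-1.
lower upper : ℕ → ℕ
lower r = pent r ℕ.+ (r ℕ.* suc r ℕ.+ r ℕ.* suc r)
upper r = lower r ℕ.+ (2 ℕ.+ r ℕ.* 4)

-- Finite sums and products modulo q^T

module Truncated (R : CommutativeRing 0ℓ 0ℓ) (1+1≈0 : Characteristic-2 R)
  (q : CommutativeRing.Carrier R) (t : ℕ) (q^T≈0 : PowerVanishes R q (suc t)) where

  open CommutativeRing R
  open Algebra.Properties.Semiring.Exp semiring
  open Characteristic2 R 1+1≈0
  open Solver using (solve; _:+_; _:*_; _:^_; _:=_; con)
  open import Relation.Binary.Reasoning.Setoid setoid
  open +-*-Solver using () renaming (solve to solveℕ; _:+_ to _⊕_; _:*_ to _⊗_; _:=_ to _⊜_; con to conℕ)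

  T : ℕ
  T = suc t

  ∑ : ℕ → (ℕ → Carrier) → Carrier
  ∑ zero    f = 0#
  ∑ (suc n) f = ∑ n f + f n

  ∑-cong : ∀ n {f g : ℕ → Carrier} → (∀ i → i ℕ.< n → f i ≈ g i) → ∑ n f ≈ ∑ n g
  ∑-cong zero    eq = refl
  ∑-cong (suc n) eq = +-cong (∑-cong n λ i i<n → eq i (ℕₚ.m<n⇒m<1+n i<n)) (eq n ℕₚ.≤-refl)

  ∑-zero : ∀ n {f : ℕ → Carrier} → (∀ i → i ℕ.< n → f i ≈ 0#) → ∑ n f ≈ 0#
  ∑-zero zero    eq = refl
  ∑-zero (suc n) eq = trans (+-cong (∑-zero n λ i i<n → eq i (ℕₚ.m<n⇒m<1+n i<n)) (eq n ℕₚ.≤-refl)) (+-identityˡ 0#)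

  ∑-+ : ∀ n (f g : ℕ → Carrier) → ∑ n (λ i → f i + g i) ≈ ∑ n f + ∑ n g
  ∑-+ zero    f g = sym (+-identityˡ 0#)
  ∑-+ (suc n) f g = trans (+-congʳ (∑-+ n f g))
    (solve 4 (λ a b c d → (a :+ b) :+ (c :+ d) := (a :+ c) :+ (b :+ d)) refl (∑ n f) (∑ n g) (f n) (g n))

  ∑-*ˡ : ∀ n x (f : ℕ → Carrier) → ∑ n (λ i → x * f i) ≈ x * ∑ n f
  ∑-*ˡ zero    x f = sym (zeroʳ x)
  ∑-*ˡ (suc n) x f = trans (+-congʳ (∑-*ˡ n x f)) (sym (distribˡ x _ _))

  ∑-head : ∀ n (f : ℕ → Carrier) → ∑ (suc n) f ≈ f 0 + ∑ n (λ i → f (suc i))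
  ∑-head zero    f = +-comm _ _
  ∑-head (suc n) f = trans (+-congʳ (∑-head n f)) (+-assoc _ _ _)

  -- Exchange of summation with m = n - r; the rows of the triangle are padded with zeros to a
  -- common length. The parameter `d` serves the induction: splitting off the row r = 0 lowers `N`
  -- by one while the row length has to stay.
  ∑-triangle : ∀ N d (g : ℕ → ℕ → Carrier) → (∀ r m → N ℕ.≤ r ℕ.+ m → g r m ≈ 0#) →
    ∑ N (λ n → ∑ (suc n) (λ r → g r (n ℕ.∸ r))) ≈ ∑ N (λ r → ∑ (d ℕ.+ N) (g r))
  ∑-triangle zero    d g g≈0 = refl
  ∑-triangle (suc N) d g g≈0 = begin
    ∑ (suc N) (λ n → ∑ (suc n) (λ r → g r (n ℕ.∸ r)))
      ≈⟨ ∑-cong (suc N) (λ n _ → ∑-head n (λ r → g r (n ℕ.∸ r))) ⟩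
    ∑ (suc N) (λ n → g 0 n + ∑ n (λ r → g (suc r) (n ℕ.∸ suc r)))
      ≈⟨ ∑-+ (suc N) (g 0) _ ⟩
    ∑ (suc N) (g 0) + ∑ (suc N) (λ n → ∑ n (λ r → g (suc r) (n ℕ.∸ suc r)))
      ≈⟨ +-cong (sym (extend d)) (trans (∑-head N _) (+-identityˡ _)) ⟩
    ∑ (d ℕ.+ suc N) (g 0) + ∑ N (λ n → ∑ (suc n) (λ r → g (suc r) (n ℕ.∸ r)))
      ≈⟨ +-congˡ (∑-triangle N (suc d) (λ r → g (suc r)) λ r m N≤ → g≈0 (suc r) m (s≤s N≤)) ⟩
    ∑ (d ℕ.+ suc N) (g 0) + ∑ N (λ r → ∑ (suc d ℕ.+ N) (g (suc r)))
      ≡⟨ ≡.cong (λ k → ∑ (d ℕ.+ suc N) (g 0) + ∑ N (λ r → ∑ k (g (suc r)))) (≡.sym (ℕₚ.+-suc d N)) ⟩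
    ∑ (d ℕ.+ suc N) (g 0) + ∑ N (λ r → ∑ (d ℕ.+ suc N) (g (suc r)))
      ≈⟨ ∑-head N _ ⟨
    ∑ (suc N) (λ r → ∑ (d ℕ.+ suc N) (g r)) ∎
    where
    extend : ∀ d → ∑ (d ℕ.+ suc N) (g 0) ≈ ∑ (suc N) (g 0)
    extend zero    = refl
    extend (suc d) = trans (+-cong (extend d) (g≈0 0 (d ℕ.+ suc N) (ℕₚ.m≤n+m (suc N) d))) (+-identityʳ _)

  Q : ℕ → Carrier
  Q k = q ^ k * q ^ k

  q^-homo : ∀ m n → q ^ (m ℕ.+ n) ≈ q ^ m * q ^ n
  q^-homo = ^-homo-* q

  Q-homo : ∀ m n → Q (m ℕ.+ n) ≈ Q m * Q n
  Q-homo m n = trans (*-cong (q^-homo m n) (q^-homo m n))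
    (solve 2 (λ a b → (a :* b) :* (a :* b) := (a :* a) :* (b :* b)) refl (q ^ m) (q ^ n))

  q^k≈0 : ∀ {k} → T ℕ.≤ k → q ^ k ≈ 0#
  q^k≈0 {k} T≤k = begin
    q ^ k                        ≡⟨ ≡.cong (q ^_) (≡.sym (ℕₚ.m+[n∸m]≡n T≤k)) ⟩
    q ^ (T ℕ.+ (k ℕ.∸ T))        ≈⟨ q^-homo T (k ℕ.∸ T) ⟩
    q ^ T * q ^ (k ℕ.∸ T)        ≈⟨ *-congʳ q^T≈0 ⟩
    0# * q ^ (k ℕ.∸ T)           ≈⟨ zeroˡ _ ⟩
    0#                           ∎

  Q≈0 : ∀ {k} → T ℕ.≤ k → Q k ≈ 0#
  Q≈0 T≤k = trans (*-congʳ (q^k≈0 T≤k)) (zeroˡ _)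

  geometric : ∀ n a → (1# + a) * ∑ n (a ^_) ≈ 1# + a ^ n
  geometric zero    a = trans (zeroʳ _) (sym 1+1≈0)
  geometric (suc n) a = begin
    (1# + a) * (∑ n (a ^_) + a ^ n)           ≈⟨ distribˡ _ _ _ ⟩
    (1# + a) * ∑ n (a ^_) + (1# + a) * a ^ n  ≈⟨ +-congʳ (geometric n a) ⟩
    1# + a ^ n + (1# + a) * a ^ n             ≈⟨ solve 2 (λ a p → con true :+ p :+ (con true :+ a) :* p := con true :+ a :* p) refl a (a ^ n) ⟩
    1# + a * a ^ n                            ∎

  -- The geometric series for 1 / (1 + q^(2k+2)). It may stop after `T` terms because the exponent
  -- is positive and q is nilpotent.
  inv : ℕ → Carrier
  inv k = ∑ T (Q (suc k) ^_)

  inv-inverse : ∀ k → (1# + Q (suc k)) * inv k ≈ 1#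
  inv-inverse k = trans (geometric T (Q (suc k))) (trans (+-congˡ Q^T≈0) (+-identityʳ 1#))
    where
    Q^T≈0 : Q (suc k) ^ T ≈ 0#
    Q^T≈0 = begin
      Q (suc k) ^ T                 ≈⟨ ^-congˡ T (^-homo-* q (suc k) (suc k)) ⟨
      (q ^ (suc k ℕ.+ suc k)) ^ T   ≈⟨ ^-assocʳ q (suc k ℕ.+ suc k) T ⟩
      q ^ ((suc k ℕ.+ suc k) ℕ.* T) ≈⟨ q^k≈0 (ℕₚ.m≤m+n T _) ⟩
      0#                            ∎

  -- y k is 1 / (q²;q²)ₖ.
  y : ℕ → Carrier
  y zero    = 1#
  y (suc k) = y k * inv k

  y-step : ∀ k → y k ≈ (1# + Q (suc k)) * y (suc k)
  y-step k = sym (begin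
    (1# + Q (suc k)) * (y k * inv k)  ≈⟨ solve 3 (λ a b c → a :* (b :* c) := b :* (a :* c)) refl _ _ _ ⟩
    y k * ((1# + Q (suc k)) * inv k)  ≈⟨ *-congˡ (inv-inverse k) ⟩
    y k * 1#                          ≈⟨ *-identityʳ _ ⟩
    y k                               ∎)

  1+Q-cancel : ∀ k {a b} → (1# + Q (suc k)) * a ≈ (1# + Q (suc k)) * b → a ≈ b
  1+Q-cancel k {a} {b} eq = trans (sym (undo a)) (trans (*-congˡ eq) (undo b))
    where
    undo : ∀ a → inv k * ((1# + Q (suc k)) * a) ≈ a
    undo a = begin
      inv k * ((1# + Q (suc k)) * a)  ≈⟨ solve 3 (λ a b c → a :* (b :* c) := (b :* a) :* c) refl _ _ _ ⟩
      (1# + Q (suc k)) * inv k * a    ≈⟨ *-congʳ (inv-inverse k) ⟩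
      1# * a                          ≈⟨ *-identityˡ a ⟩
      a                               ∎

  -- The factors 1 + q^(2i) with i ≥ T are 1, so `y T` stands for 1 / (q²;q²)_∞.
  y-stable : ∀ k → y (k ℕ.+ T) ≈ y T
  y-stable zero    = refl
  y-stable (suc k) = trans (sym (begin
    y (k ℕ.+ T)                                  ≈⟨ y-step (k ℕ.+ T) ⟩
    (1# + Q (suc k ℕ.+ T)) * y (suc k ℕ.+ T)     ≈⟨ *-congʳ (trans (+-congˡ (Q≈0 (ℕₚ.m≤n+m T (suc k)))) (+-identityʳ 1#)) ⟩
    1# * y (suc k ℕ.+ T)                         ≈⟨ *-identityˡ _ ⟩
    y (suc k ℕ.+ T)                              ∎)) (y-stable k)

  -- `tail m k` is (q^(2m+2);q²)_k, signs being immaterial. At k = T it already is the infinite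
  -- product, since all later factors are 1 modulo q^T.
  tail : ℕ → ℕ → Carrier
  tail m zero    = 1#
  tail m (suc k) = tail m k * (1# + Q (m ℕ.+ suc k))

  tail-y : ∀ m k → tail m k * y (m ℕ.+ k) ≈ y m
  tail-y m zero    = trans (*-identityˡ _) (reflexive (≡.cong y (ℕₚ.+-identityʳ m)))
  tail-y m (suc k) rewrite ℕₚ.+-suc m k = begin
    tail m k * (1# + Q (suc (m ℕ.+ k))) * y (suc (m ℕ.+ k))    ≈⟨ *-assoc _ _ _ ⟩
    tail m k * ((1# + Q (suc (m ℕ.+ k))) * y (suc (m ℕ.+ k)))  ≈⟨ *-congˡ (y-step (m ℕ.+ k)) ⟨
    tail m k * y (m ℕ.+ k)                                     ≈⟨ tail-y m k ⟩
    y m                                                        ∎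

  tail-T : ∀ m → tail m T * y T ≈ y m
  tail-T m = trans (*-congˡ (sym (y-stable m))) (tail-y m T)

  tail-quotient : ∀ m → tail m T ≈ tail 0 T * y m
  tail-quotient m = begin
    tail m T                      ≈⟨ *-identityʳ _ ⟨
    tail m T * 1#                 ≈⟨ *-congˡ (tail-T 0) ⟨
    tail m T * (tail 0 T * y T)   ≈⟨ solve 3 (λ a b c → a :* (b :* c) := b :* (a :* c)) refl _ _ _ ⟩
    tail 0 T * (tail m T * y T)   ≈⟨ *-congˡ (tail-T m) ⟩
    tail 0 T * y m                ∎

  -- The Durfee rectangle identity

  durfeeTerm : ℕ → ℕ → Carrier
  durfeeTerm s m = Q (m ℕ.* (m ℕ.+ s)) * (y m * y (m ℕ.+ s))

  -- In characteristic 2 this sum is a difference. The right side is `durfeeTerm s (suc N)` with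
  -- `y N` in place of `y (suc N)`; its exponent grows with `N`, so truncation removes it at
  -- `suc N = T`.
  durfee-telescope : ∀ s N → ∑ (suc N) (durfeeTerm s) + ∑ (suc N) (durfeeTerm (suc s)) ≈
    Q (suc N ℕ.* (suc N ℕ.+ s)) * (y N * y (suc N ℕ.+ s))
  durfee-telescope s zero = begin
    (0# + 1# * 1# * (1# * y s)) + (0# + 1# * 1# * (1# * y (suc s)))
      ≈⟨ solve 2 (λ a b → (con false :+ con true :* con true :* (con true :* a)) :+ (con false :+ con true :* con true :* (con true :* b))
           := a :+ b) refl (y s) (y (suc s)) ⟩
    y s + y (suc s)
      ≈⟨ +-congʳ (y-step s) ⟩
    (1# + Q (suc s)) * y (suc s) + y (suc s)
      ≈⟨ solve 2 (λ a b → (con true :+ a) :* b :+ b := a :* (con true :* b)) refl (Q (suc s)) (y (suc s)) ⟩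
    Q (suc s) * (1# * y (suc s))
      ≡⟨ ≡.cong (λ k → Q k * (1# * y (suc s))) (≡.sym (ℕₚ.*-identityˡ (suc s))) ⟩
    Q (1 ℕ.* suc s) * (1# * y (suc s)) ∎
  durfee-telescope s (suc N) = begin
    (∑ M (durfeeTerm s) + durfeeTerm s M) + (∑ M (durfeeTerm (suc s)) + durfeeTerm (suc s) M)
      ≈⟨ solve 4 (λ a b c d → (a :+ b) :+ (c :+ d) := (a :+ c) :+ (b :+ d)) refl _ _ _ _ ⟩
    (∑ M (durfeeTerm s) + ∑ M (durfeeTerm (suc s))) + (durfeeTerm s M + durfeeTerm (suc s) M)
      ≈⟨ +-congʳ (durfee-telescope s N) ⟩
    x * (y N * y (M ℕ.+ s)) + (x * (y M * y (M ℕ.+ s)) + durfeeTerm (suc s) M)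
      ≈⟨ +-cong (*-congˡ (*-cong (y-step N) (y-step (M ℕ.+ s))))
           (+-cong (*-congˡ (*-congˡ (y-step (M ℕ.+ s)))) (*-cong Qsucs (*-congˡ (reflexive (≡.cong y (ℕₚ.+-suc M s)))))) ⟩
    x * ((1# + a) * Y * ((1# + b) * Z)) + (x * (Y * ((1# + b) * Z)) + x * a * (Y * Z))
      -- Over the common denominator the claim is (1+a)(1+b) + (1+b) + a = ab.
      ≈⟨ solve 5 (λ x a b Y Z → x :* ((con true :+ a) :* Y :* ((con true :+ b) :* Z)) :+ (x :* (Y :* ((con true :+ b) :* Z)) :+ x :* a :* (Y :* Z))
           := x :* a :* b :* (Y :* Z)) refl x a b Y Z ⟩
    x * a * b * (Y * Z)
      ≈⟨ *-congʳ Qnext ⟨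
    Q (suc M ℕ.* (suc M ℕ.+ s)) * (Y * Z) ∎
    where
    M = suc N
    x = Q (M ℕ.* (M ℕ.+ s))
    a = Q M
    b = Q (suc (M ℕ.+ s))
    Y = y M
    Z = y (suc (M ℕ.+ s))
    Qsucs : Q (M ℕ.* (M ℕ.+ suc s)) ≈ x * a
    Qsucs = trans (reflexive (≡.cong Q (solveℕ 2 (λ m s → m ⊗ (m ⊕ (conℕ 1 ⊕ s)) ⊜ m ⊗ (m ⊕ s) ⊕ m) ≡.refl M s)))
      (Q-homo (M ℕ.* (M ℕ.+ s)) M)
    Qnext : Q (suc M ℕ.* (suc M ℕ.+ s)) ≈ x * a * b
    Qnext = trans (reflexive (≡.cong Q (solveℕ 2 (λ m s → (conℕ 1 ⊕ m) ⊗ (conℕ 1 ⊕ m ⊕ s) ⊜ m ⊗ (m ⊕ s) ⊕ m ⊕ (conℕ 1 ⊕ (m ⊕ s))) ≡.refl M s)))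
      (trans (Q-homo (M ℕ.* (M ℕ.+ s) ℕ.+ M) (suc (M ℕ.+ s))) (*-congʳ (Q-homo (M ℕ.* (M ℕ.+ s)) M)))

  durfee-suc : ∀ s → ∑ T (durfeeTerm s) ≈ ∑ T (durfeeTerm (suc s))
  durfee-suc s = x+y≈0⇒x≈y (trans (durfee-telescope s t)
    (trans (*-congʳ (Q≈0 (ℕₚ.m≤m*n T (T ℕ.+ s)))) (zeroˡ _)))

  durfee-shift : ∀ k s → ∑ T (durfeeTerm s) ≈ ∑ T (durfeeTerm (k ℕ.+ s))
  durfee-shift zero    s = refl
  durfee-shift (suc k) s = trans (durfee-shift k s) (durfee-suc (k ℕ.+ s))

  durfee : ∀ s → ∑ T (durfeeTerm s) ≈ y T
  durfee s = begin
    -- Shifting s by `T` pushes every term with m > 0 beyond the truncation.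
    ∑ T (durfeeTerm s)           ≈⟨ durfee-shift T s ⟩
    ∑ T (durfeeTerm (T ℕ.+ s))   ≈⟨ ∑-head t (durfeeTerm (T ℕ.+ s)) ⟩
    1# * 1# * (1# * y (T ℕ.+ s)) + ∑ t (λ i → durfeeTerm (T ℕ.+ s) (suc i))
      ≈⟨ +-cong (solve 1 (λ a → con true :* con true :* (con true :* a) := a) refl _)
           (∑-zero t λ i _ → trans (*-congʳ (Q≈0 (ℕₚ.≤-trans (ℕₚ.m≤m+n T s) (ℕₚ.≤-trans (ℕₚ.m≤n+m (T ℕ.+ s) (suc i)) (ℕₚ.m≤m+n _ _))))) (zeroˡ _)) ⟩
    y (T ℕ.+ s) + 0#             ≈⟨ +-identityʳ _ ⟩
    y (T ℕ.+ s)                  ≡⟨ ≡.cong y (ℕₚ.+-comm T s) ⟩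
    y (s ℕ.+ T)                  ≈⟨ y-stable s ⟩
    y T                          ∎

  -- The Bailey pair, by creative telescoping

  module Bailey where
    -- The variable of the certificate: passing from r to r + 1 is the substitution w ↦ qw.
    w : ℕ → Carrier
    w r = q ^ r

    -- Defined by its ratio q w³, a monomial in q and w, which is the form that the polynomial
    -- identities below use; `e≈` gives the closed form.
    e : ℕ → Carrier
    e zero    = 1#
    e (suc r) = e r * (q * (w r ^ 3))

    e≈ : ∀ r → e r ≈ q ^ pent r
    e≈ zero    = refl
    e≈ (suc r) = sym (begin
      q ^ (pent r ℕ.+ suc (3 ℕ.* r))   ≈⟨ q^-homo (pent r) (suc (3 ℕ.* r)) ⟩
      q ^ pent r * (q * q ^ (3 ℕ.* r)) ≡⟨ ≡.cong (λ k → q ^ pent r * (q * q ^ k)) (ℕₚ.*-comm 3 r) ⟩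
      q ^ pent r * (q * q ^ (r ℕ.* 3)) ≈⟨ *-cong (e≈ r) (*-congˡ (^-assocʳ q r 3)) ⟨
      e r * (q * w r ^ 3)              ∎)

    -- (α, β) is a Bailey pair in base q² relative to q².
    α : ℕ → Carrier
    α r = e r * (1# + q ^ 2 * w r ^ 4)

    β-term : ℕ → ℕ → Carrier
    β-term n r = α r * (y (n ℕ.∸ r) * y (suc (n ℕ.+ r)))

    β : ℕ → Carrier
    β n = ∑ (suc n) (β-term n)

    u : ℕ → Carrier
    u n = q * Q n

    oddFactor : ℕ → Carrier
    oddFactor zero    = 1#
    oddFactor (suc n) = oddFactor n * (1# + u n)

    -- The recurrence of `β-recurrence` applied to the r-th summand. As `u n` is q^(2n+1), the first
    -- two factors are 1 + q^(4n+2) and 1 + q^(4n+4), which turn 1 / (q²;q²)_{2n+2} into 1 /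
    -- (q²;q²)_{2n}; the factor 1 + `u n` is the ratio of `oddFactor`.
    diff : ℕ → ℕ → Carrier
    diff n r = (1# + u n ^ 2) * (1# + u n ^ 2 * q ^ 2) * β-term (suc n) r + (1# + u n) * β-term n r

    -- The certificate found by creative telescoping, cleared of its denominator.
    certificate : Carrier → Carrier → Carrier
    certificate w u = w + u * q * w ^ 2 + (1# + u * q ^ 2) * q * w ^ 3 + (1# + u * q ^ 2) * q ^ 2 * w ^ 4 + u * q ^ 4 * w ^ 5 + q ^ 5 * w ^ 6

    certificateₚ : ∀ {k} → Solver.Polynomial k → Solver.Polynomial k → Solver.Polynomial k → Solver.Polynomial k
    certificateₚ q w u = w :+ u :* q :* w :^ 2 :+ (con true :+ u :* q :^ 2) :* q :* w :^ 3 :+ (con true :+ u :* q :^ 2) :* q :^ 2 :* w :^ 4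
      :+ u :* q :^ 4 :* w :^ 5 :+ q :^ 5 :* w :^ 6

    -- Here n = m + r, so that n - r is the variable `m` and no truncated subtraction occurs. The
    -- denominator is (q²;q²)_{n-r} (q²;q²)_{n+r+2}.
    antidifference : ℕ → ℕ → Carrier
    antidifference m r = u (m ℕ.+ r) * (1# + u (m ℕ.+ r)) * (e r * certificate (w r) (u (m ℕ.+ r))) * (y m * y (suc (suc (m ℕ.+ r ℕ.+ r))))

    Q-suc : ∀ k → Q (suc k) ≈ q ^ 2 * Q k
    Q-suc k = solve 2 (λ q a → (q :* a) :* (q :* a) := q :^ 2 :* (a :* a)) refl q (q ^ k)

    u-+ : ∀ m r → u (m ℕ.+ r) ≈ q * Q m * w r ^ 2
    u-+ m r = trans (*-congˡ (Q-homo m r))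
      (solve 3 (λ q v w → q :* (v :* (w :* w)) := q :* v :* w :^ 2) refl q (Q m) (w r))

    Q-m+r+r+2 : ∀ m r → Q (suc (suc (m ℕ.+ r ℕ.+ r))) ≈ q ^ 4 * Q m * w r ^ 4
    Q-m+r+r+2 m r = trans (Q-suc (suc (m ℕ.+ r ℕ.+ r))) (trans (*-congˡ (trans (Q-suc (m ℕ.+ r ℕ.+ r))
        (*-congˡ (trans (Q-homo (m ℕ.+ r) r) (*-congʳ (Q-homo m r))))))
      (solve 3 (λ q v w → q :^ 2 :* (q :^ 2 :* (v :* (w :* w) :* (w :* w))) := q :^ 4 :* v :* w :^ 4) refl q (Q m) (w r)))

    -- Both terms of `diff` are brought over (q²;q²)_{m+1} (q²;q²)_{m+2r+2}; apart from `e r`, the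
    -- numerator is a polynomial in q, q^(2m) and `w r`.
    diff-closed : ∀ m r → diff (m ℕ.+ r) r ≈
      ((1# + (q * Q m * w r ^ 2) ^ 2) * (1# + (q * Q m * w r ^ 2) ^ 2 * q ^ 2)
        + (1# + q * Q m * w r ^ 2) * (1# + q ^ 2 * Q m) * (1# + q ^ 4 * Q m * w r ^ 4))
      * (e r * (1# + q ^ 2 * w r ^ 4)) * (y (suc m) * y (suc (suc (m ℕ.+ r ℕ.+ r))))
    diff-closed m r = begin
      diff (m ℕ.+ r) r
        ≡⟨ ≡.cong₂ (λ i j → (1# + u (m ℕ.+ r) ^ 2) * (1# + u (m ℕ.+ r) ^ 2 * q ^ 2) * (α r * (y i * Z))
               + (1# + u (m ℕ.+ r)) * (α r * (y j * y (suc (m ℕ.+ r ℕ.+ r)))))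
             (ℕₚ.m+n∸n≡m (suc m) r) (ℕₚ.m+n∸n≡m m r) ⟩
      (1# + u (m ℕ.+ r) ^ 2) * (1# + u (m ℕ.+ r) ^ 2 * q ^ 2) * (α r * (Y * Z)) + (1# + u (m ℕ.+ r)) * (α r * (y m * y (suc (m ℕ.+ r ℕ.+ r))))
        ≈⟨ +-cong (*-congʳ (*-cong (+-congˡ (^-congˡ 2 (u-+ m r))) (+-congˡ (*-congʳ (^-congˡ 2 (u-+ m r))))))
             (*-cong (+-congˡ (u-+ m r)) (*-congˡ (*-cong (trans (y-step m) (*-congʳ (+-congˡ (Q-suc m))))
               (trans (y-step (suc (m ℕ.+ r ℕ.+ r))) (*-congʳ (+-congˡ (Q-m+r+r+2 m r))))))) ⟩
      (1# + U ^ 2) * (1# + U ^ 2 * q ^ 2) * (α r * (Y * Z)) + (1# + U) * (α r * ((1# + a) * Y * ((1# + b) * Z)))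
        ≈⟨ solve 7 (λ U q α Y Z a b → (con true :+ U :^ 2) :* (con true :+ U :^ 2 :* q :^ 2) :* (α :* (Y :* Z))
               :+ (con true :+ U) :* (α :* ((con true :+ a) :* Y :* ((con true :+ b) :* Z)))
             := ((con true :+ U :^ 2) :* (con true :+ U :^ 2 :* q :^ 2) :+ (con true :+ U) :* (con true :+ a) :* (con true :+ b)) :* α :* (Y :* Z))
             refl U q (α r) Y Z a b ⟩
      ((1# + U ^ 2) * (1# + U ^ 2 * q ^ 2) + (1# + U) * (1# + a) * (1# + b)) * α r * (Y * Z) ∎
      where
      Y = y (suc m)
      Z = y (suc (suc (m ℕ.+ r ℕ.+ r)))
      U = q * Q m * w r ^ 2
      a = q ^ 2 * Q m
      b = q ^ 4 * Q m * w r ^ 4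

    certificate-cong : ∀ w {u u′} → u ≈ u′ → certificate w u ≈ certificate w u′
    certificate-cong w u≈ = +-congʳ (+-cong (+-cong (+-cong (+-congˡ (*-congʳ (*-congʳ u≈))) (*-congʳ (*-congʳ (+-congˡ (*-congʳ u≈)))))
      (*-congʳ (*-congʳ (+-congˡ (*-congʳ u≈))))) (*-congʳ (*-congʳ u≈)))

    antidifference-closed : ∀ m r {U} → u (m ℕ.+ r) ≈ U → antidifference m r ≈
      U * (1# + U) * (e r * certificate (w r) U) * (y m * y (suc (suc (m ℕ.+ r ℕ.+ r))))
    antidifference-closed m r u≈ = *-congʳ (*-cong (*-cong u≈ (+-congˡ u≈)) (*-congˡ (certificate-cong (w r) u≈)))

    -- Induction on r with n = m + r fixed: the case r + 1 for `m` rests on the case r for `suc m`.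
    -- As `u` depends only on n, the same `U` serves both.
    partial-sum : ∀ r m → ∑ (suc r) (diff (m ℕ.+ r)) ≈ antidifference m r
    partial-sum zero m = begin
      0# + diff (m ℕ.+ 0) 0
        ≈⟨ +-congˡ (diff-closed m 0) ⟩
      0# + _
        ≈⟨ solve 4 (λ q v Y Z → con false :+
             ((con true :+ (q :* v :* con true :^ 2) :^ 2) :* (con true :+ (q :* v :* con true :^ 2) :^ 2 :* q :^ 2)
              :+ (con true :+ q :* v :* con true :^ 2) :* (con true :+ q :^ 2 :* v) :* (con true :+ q :^ 4 :* v :* con true :^ 4))
             :* (con true :* (con true :+ q :^ 2 :* con true :^ 4)) :* (Y :* Z)
             := (q :* v :* con true :^ 2) :* (con true :+ q :* v :* con true :^ 2) :* (con true :* certificateₚ q (con true) (q :* v :* con true :^ 2))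
                :* ((con true :+ q :^ 2 :* v) :* Y :* Z)) refl q (Q m) (y (suc m)) (y (suc (suc (m ℕ.+ 0 ℕ.+ 0)))) ⟩
      _ ≈⟨ *-congˡ (*-congʳ (trans (y-step m) (*-congʳ (+-congˡ (Q-suc m))))) ⟨
      _ ≈⟨ antidifference-closed m 0 (u-+ m 0) ⟨
      antidifference m 0 ∎
    partial-sum (suc r) m = begin
      ∑ (suc r) (diff (m ℕ.+ suc r)) + diff (m ℕ.+ suc r) (suc r)
        ≡⟨ ≡.cong (λ k → ∑ (suc r) (diff k) + diff (m ℕ.+ suc r) (suc r)) (ℕₚ.+-suc m r) ⟩
      ∑ (suc r) (diff (suc m ℕ.+ r)) + diff (m ℕ.+ suc r) (suc r)
        ≈⟨ +-cong (trans (partial-sum r (suc m)) (antidifference-closed (suc m) r (trans (reflexive (≡.cong u (≡.sym (ℕₚ.+-suc m r)))) (u-+ m (suc r)))))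
            (diff-closed m (suc r)) ⟩
      U * (1# + U) * (e r * certificate (w r) U) * (Y * y (suc (suc (suc m ℕ.+ r ℕ.+ r)))) + _
        ≈⟨ +-congʳ (*-congˡ (*-congˡ (trans (y-step (suc (suc (suc m ℕ.+ r ℕ.+ r))))
             (trans (reflexive (≡.cong (λ k → (1# + Q (suc (suc k))) * y (suc (suc k))) eq))
             (*-congʳ (+-congˡ (Q-m+r+r+2 m (suc r)))))))) ⟩
      U * (1# + U) * (e r * certificate (w r) U) * (Y * ((1# + q ^ 4 * Q m * w (suc r) ^ 4) * Z)) + _
        -- Here v = q^(2m), while w' and e' are `w` and `e` at `suc r`, monomial multiples of their
        -- values at r.
        ≈⟨ solve 6 (λ q v w e Y Z → let w' = q :* w ; U = q :* v :* w' :^ 2 ; e' = e :* (q :* (w :^ 3)) in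
             U :* (con true :+ U) :* (e :* certificateₚ q w U) :* (Y :* ((con true :+ q :^ 4 :* v :* w' :^ 4) :* Z))
             :+ ((con true :+ U :^ 2) :* (con true :+ U :^ 2 :* q :^ 2) :+ (con true :+ U) :* (con true :+ q :^ 2 :* v) :* (con true :+ q :^ 4 :* v :* w' :^ 4))
                :* (e' :* (con true :+ q :^ 2 :* w' :^ 4)) :* (Y :* Z)
             := U :* (con true :+ U) :* (e' :* certificateₚ q w' U) :* ((con true :+ q :^ 2 :* v) :* Y :* Z)) refl q (Q m) (w r) (e r) Y Z ⟩
      _ ≈⟨ *-congˡ (*-congʳ (trans (y-step m) (*-congʳ (+-congˡ (Q-suc m))))) ⟨
      _ ≈⟨ antidifference-closed m (suc r) (u-+ m (suc r)) ⟨
      antidifference m (suc r) ∎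
      where
      Y = y (suc m)
      Z = y (suc (suc (m ℕ.+ suc r ℕ.+ suc r)))
      U = q * Q m * w (suc r) ^ 2
      eq : suc (suc m ℕ.+ r ℕ.+ r) ≡ m ℕ.+ suc r ℕ.+ suc r
      eq = ≡.trans (≡.sym (ℕₚ.+-suc (suc m ℕ.+ r) r)) (≡.cong (ℕ._+ suc r) (≡.sym (ℕₚ.+-suc m r)))

    -- The terms r ≤ n telescope to the boundary value `antidifference 0 n`. It cancels against the
    -- term r = n + 1, which `β (suc n)` has and `β n` lacks.
    β-recurrence : ∀ n → (1# + u n ^ 2) * (1# + u n ^ 2 * q ^ 2) * β (suc n) ≈ (1# + u n) * β n
    β-recurrence n = x+y≈0⇒x≈y (begin
      c * (∑ (suc n) (β-term (suc n)) + β-term (suc n) (suc n)) + (1# + u n) * ∑ (suc n) (β-term n)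
        ≈⟨ solve 5 (λ c A b d B → c :* (A :+ b) :+ d :* B := (c :* A :+ d :* B) :+ c :* b) refl c _ _ (1# + u n) _ ⟩
      c * ∑ (suc n) (β-term (suc n)) + (1# + u n) * ∑ (suc n) (β-term n) + c * β-term (suc n) (suc n)
        ≈⟨ +-congʳ (trans (∑-+ (suc n) (λ r → c * β-term (suc n) r) (λ r → (1# + u n) * β-term n r))
             (+-cong (∑-*ˡ (suc n) c _) (∑-*ˡ (suc n) (1# + u n) _))) ⟨
      ∑ (suc n) (diff n) + c * β-term (suc n) (suc n)
        ≈⟨ +-cong (partial-sum n 0) (*-congˡ (*-congˡ (*-congʳ (reflexive (≡.cong y (ℕₚ.n∸n≡0 n)))))) ⟩
      antidifference 0 n + c * (α (suc n) * (1# * Z))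
        ≈⟨ +-cong (trans (antidifference-closed 0 n u≈) (*-congˡ (*-congˡ (trans (y-step (suc (suc (n ℕ.+ n))))
               (*-cong (+-congˡ Q≈) (reflexive (≡.cong y (≡.cong (λ k → suc (suc k)) (≡.sym (ℕₚ.+-suc n n))))))))))
             (*-congʳ (*-cong (+-congˡ (^-congˡ 2 u≈)) (+-congˡ (*-congʳ (^-congˡ 2 u≈))))) ⟩
      _ ≈⟨ solve 4 (λ q w e Z → let w' = q :* w ; U = q :* w :^ 2 ; e' = e :* (q :* (w :^ 3)) in
             U :* (con true :+ U) :* (e :* certificateₚ q w U) :* (con true :* ((con true :+ q :^ 6 :* w :^ 4) :* Z))
             :+ (con true :+ U :^ 2) :* (con true :+ U :^ 2 :* q :^ 2) :* (e' :* (con true :+ q :^ 2 :* w' :^ 4) :* (con true :* Z))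
             := con false) refl q (w n) (e n) Z ⟩
      0# ∎)
      where
      c = (1# + u n ^ 2) * (1# + u n ^ 2 * q ^ 2)
      Z = y (suc (suc n ℕ.+ suc n))
      u≈ : u n ≈ q * w n ^ 2
      u≈ = *-congˡ (*-congˡ (sym (*-identityʳ _)))
      Q≈ : Q (suc (suc (suc (n ℕ.+ n)))) ≈ q ^ 6 * w n ^ 4
      Q≈ = trans (Q-suc (suc (suc (n ℕ.+ n)))) (trans (*-congˡ (Q-m+r+r+2 0 n))
        (solve 2 (λ q w → q :^ 2 :* (q :^ 4 :* (con true :* con true) :* w :^ 4) := q :^ 6 :* w :^ 4) refl q (w n)))

    -- Both sides satisfy the recurrence, and its leading coefficient is a product of two units, so
    -- it can be cancelled.
    β-closed : ∀ n → β n ≈ oddFactor n * y (n ℕ.+ n)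
    β-closed zero = begin
      0# + 1# * (1# + q ^ 2 * 1# ^ 4) * (1# * y 1)
        ≈⟨ solve 2 (λ q Y → con false :+ con true :* (con true :+ q :^ 2 :* con true :^ 4) :* (con true :* Y)
             := (con true :+ (q :* con true) :* (q :* con true)) :* Y) refl q (y 1) ⟩
      (1# + Q 1) * y 1      ≈⟨ y-step 0 ⟨
      1#                    ≈⟨ *-identityˡ 1# ⟨
      1# * 1#               ∎
    β-closed (suc n) = 1+Q-cancel (n ℕ.+ n) (1+Q-cancel (suc (n ℕ.+ n)) (begin
      b * (a * β (suc n))
        ≈⟨ solve 3 (λ a b c → b :* (a :* c) := a :* b :* c) refl a b _ ⟩
      a * b * β (suc n)
        ≈⟨ *-congʳ (*-cong (+-congˡ a≈) (+-congˡ b≈)) ⟩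
      (1# + u n ^ 2) * (1# + u n ^ 2 * q ^ 2) * β (suc n)
        ≈⟨ β-recurrence n ⟩
      (1# + u n) * β n
        ≈⟨ *-congˡ (trans (β-closed n) (*-congˡ (trans (y-step (n ℕ.+ n)) (*-congˡ (y-step (suc (n ℕ.+ n))))))) ⟩
      (1# + u n) * (oddFactor n * (a * (b * y (suc (suc (n ℕ.+ n))))))
        ≈⟨ solve 5 (λ a b c d e → c :* (d :* (a :* (b :* e))) := b :* (a :* (d :* c :* e))) refl a b (1# + u n) (oddFactor n) _ ⟩
      b * (a * (oddFactor n * (1# + u n) * y (suc (suc (n ℕ.+ n)))))
        ≡⟨ ≡.cong (λ k → b * (a * (oddFactor n * (1# + u n) * y (suc k)))) (≡.sym (ℕₚ.+-suc n n)) ⟩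
      b * (a * (oddFactor (suc n) * y (suc n ℕ.+ suc n))) ∎))
      where
      a = 1# + Q (suc (n ℕ.+ n))
      b = 1# + Q (suc (suc (n ℕ.+ n)))
      a≈ : Q (suc (n ℕ.+ n)) ≈ u n ^ 2
      a≈ = trans (Q-suc (n ℕ.+ n)) (trans (*-congˡ (Q-homo n n)) (solve 2 (λ q v → q :^ 2 :* (v :* v) := (q :* v) :^ 2) refl q (Q n)))
      b≈ : Q (suc (suc (n ℕ.+ n))) ≈ u n ^ 2 * q ^ 2
      b≈ = trans (Q-suc (suc (n ℕ.+ n))) (trans (*-comm _ _) (*-congʳ a≈))

    -- The Rogers-Selberg identity modulo 2

    summand : ℕ → Carrier
    summand n = Q (n ℕ.* suc n) * oddFactor n * tail (n ℕ.+ n) T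

    summand-expand : ∀ n → summand n ≈ tail 0 T * ∑ (suc n) (λ r → Q (n ℕ.* suc n) * β-term n r)
    summand-expand n = begin
      Q (n ℕ.* suc n) * oddFactor n * tail (n ℕ.+ n) T
        ≈⟨ *-congˡ (tail-quotient (n ℕ.+ n)) ⟩
      Q (n ℕ.* suc n) * oddFactor n * (tail 0 T * y (n ℕ.+ n))
        ≈⟨ solve 4 (λ a b c d → a :* b :* (c :* d) := c :* (a :* (b :* d))) refl _ _ _ _ ⟩
      tail 0 T * (Q (n ℕ.* suc n) * (oddFactor n * y (n ℕ.+ n)))
        ≈⟨ *-congˡ (*-congˡ (β-closed n)) ⟨
      tail 0 T * (Q (n ℕ.* suc n) * β n)
        ≈⟨ *-congˡ (∑-*ˡ (suc n) _ _) ⟨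
      tail 0 T * ∑ (suc n) (λ r → Q (n ℕ.* suc n) * β-term n r) ∎

    pairTerm : ℕ → ℕ → Carrier
    pairTerm r m = Q ((m ℕ.+ r) ℕ.* suc (m ℕ.+ r)) * (α r * (y m * y (suc (m ℕ.+ r ℕ.+ r))))

    -- The exponent splits as (m+r)(m+r+1) = r(r+1) + m(m+2r+1), so for fixed r the sum over m is a
    -- Durfee sum with s = 2r + 1.
    pairTerm≈ : ∀ r m → pairTerm r m ≈ α r * Q (r ℕ.* suc r) * durfeeTerm (suc (r ℕ.+ r)) m
    pairTerm≈ r m = begin
      Q ((m ℕ.+ r) ℕ.* suc (m ℕ.+ r)) * (α r * (y m * y (suc (m ℕ.+ r ℕ.+ r))))
        ≈⟨ *-cong (trans (reflexive (≡.cong Q (solveℕ 2 (λ m r → (m ⊕ r) ⊗ (conℕ 1 ⊕ (m ⊕ r)) ⊜ r ⊗ (conℕ 1 ⊕ r) ⊕ m ⊗ (m ⊕ (conℕ 1 ⊕ (r ⊕ r)))) ≡.refl m r)))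
                    (Q-homo (r ℕ.* suc r) _))
             (*-congˡ (*-congˡ (reflexive (≡.cong y (solveℕ 2 (λ m r → conℕ 1 ⊕ (m ⊕ r ⊕ r) ⊜ m ⊕ (conℕ 1 ⊕ (r ⊕ r))) ≡.refl m r))))) ⟩
      Q (r ℕ.* suc r) * Q (m ℕ.* (m ℕ.+ suc (r ℕ.+ r))) * (α r * (y m * y (m ℕ.+ suc (r ℕ.+ r))))
        ≈⟨ solve 4 (λ a b c d → a :* b :* (c :* d) := c :* a :* (b :* d)) refl _ _ _ _ ⟩
      α r * Q (r ℕ.* suc r) * durfeeTerm (suc (r ℕ.+ r)) m ∎

    pairTerm≈0 : ∀ r m → T ℕ.≤ r ℕ.+ m → pairTerm r m ≈ 0#
    pairTerm≈0 r m T≤ = trans (*-congʳ (Q≈0 (ℕₚ.≤-trans (≡.subst (T ℕ.≤_) (ℕₚ.+-comm r m) T≤) (ℕₚ.m≤m*n (m ℕ.+ r) (suc (m ℕ.+ r)))))) (zeroˡ _)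

    rogers-selberg : ∑ T summand ≈ ∑ T (λ r → α r * Q (r ℕ.* suc r))
    rogers-selberg = begin
      ∑ T summand
        ≈⟨ ∑-cong T (λ n _ → summand-expand n) ⟩
      ∑ T (λ n → tail 0 T * ∑ (suc n) (λ r → Q (n ℕ.* suc n) * β-term n r))
        ≈⟨ ∑-*ˡ T (tail 0 T) _ ⟩
      tail 0 T * ∑ T (λ n → ∑ (suc n) (λ r → Q (n ℕ.* suc n) * β-term n r))
        -- Writing n as (n ∸ r) + r makes each term a function of r and n ∸ r, as `∑-triangle`
        -- requires.
        ≈⟨ *-congˡ (∑-cong T λ n _ → ∑-cong (suc n) λ r r<1+n →
             reflexive (≡.cong (λ k → Q (k ℕ.* suc k) * (α r * (y (n ℕ.∸ r) * y (suc (k ℕ.+ r))))) (≡.sym (ℕₚ.m∸n+n≡m (ℕₚ.≤-pred r<1+n))))) ⟩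
      tail 0 T * ∑ T (λ n → ∑ (suc n) (λ r → pairTerm r (n ℕ.∸ r)))
        ≈⟨ *-congˡ (∑-triangle T 0 pairTerm pairTerm≈0) ⟩
      tail 0 T * ∑ T (λ r → ∑ T (pairTerm r))
        ≈⟨ ∑-*ˡ T (tail 0 T) _ ⟨
      ∑ T (λ r → tail 0 T * ∑ T (pairTerm r))
        ≈⟨ ∑-cong T (λ r _ → evaluate r) ⟩
      ∑ T (λ r → α r * Q (r ℕ.* suc r)) ∎
      where
      evaluate : ∀ r → tail 0 T * ∑ T (pairTerm r) ≈ α r * Q (r ℕ.* suc r)
      evaluate r = begin
        tail 0 T * ∑ T (pairTerm r)
          ≈⟨ *-congˡ (trans (∑-cong T (λ m _ → pairTerm≈ r m)) (∑-*ˡ T (α r * Q (r ℕ.* suc r)) _)) ⟩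
        tail 0 T * (α r * Q (r ℕ.* suc r) * ∑ T (durfeeTerm (suc (r ℕ.+ r))))
          ≈⟨ *-congˡ (*-congˡ (durfee (suc (r ℕ.+ r)))) ⟩
        tail 0 T * (α r * Q (r ℕ.* suc r) * y T)
          ≈⟨ solve 3 (λ a b c → a :* (b :* c) := a :* c :* b) refl _ _ _ ⟩
        tail 0 T * y T * (α r * Q (r ℕ.* suc r))
          ≈⟨ *-congʳ (tail-T 0) ⟩
        1# * (α r * Q (r ℕ.* suc r))
          ≈⟨ *-identityˡ _ ⟩
        α r * Q (r ℕ.* suc r) ∎

    theta-term : ∀ r → α r * Q (r ℕ.* suc r) ≈ q ^ lower r + q ^ upper r
    theta-term r = sym (begin
      q ^ lower r + q ^ upper r
        ≈⟨ +-cong lower≈ (trans (q^-homo (lower r) (2 ℕ.+ r ℕ.* 4)) (*-cong lower≈ (trans (q^-homo 2 (r ℕ.* 4)) (*-congˡ (sym (^-assocʳ q r 4)))))) ⟩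
      e r * Q (r ℕ.* suc r) + e r * Q (r ℕ.* suc r) * (q ^ 2 * w r ^ 4)
        ≈⟨ solve 3 (λ a b c → a :* b :+ a :* b :* c := a :* (con true :+ c) :* b) refl _ _ _ ⟩
      α r * Q (r ℕ.* suc r) ∎)
      where
      lower≈ : q ^ lower r ≈ e r * Q (r ℕ.* suc r)
      lower≈ = trans (q^-homo (pent r) _) (*-cong (sym (e≈ r)) (q^-homo (r ℕ.* suc r) (r ℕ.* suc r)))

    theta : ∑ T summand ≈ ∑ T (λ r → q ^ lower r + q ^ upper r)
    theta = trans rogers-selberg (∑-cong T λ r _ → theta-term r)

    -- Generating function of a block

    choices : ℕ → List ℕ → Carrier
    choices x []       = 0#
    choices x (m ∷ ms) = q ^ (m ℕ.* x) + choices x ms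

    gf : (ℕ → List ℕ) → ℕ → Carrier
    gf ms zero    = 1#
    gf ms (suc N) = choices (suc N) (ms (suc N)) * gf ms N

    choices-0 : ∀ x → choices x (0 ∷ []) ≈ 1#
    choices-0 x = +-identityʳ 1#

    choices-01 : ∀ x → choices x (0 ∷ 1 ∷ []) ≈ 1# + q ^ x
    choices-01 x = +-congˡ (trans (+-identityʳ _) (reflexive (≡.cong (q ^_) (ℕₚ.*-identityˡ x))))

    choices-2 : ∀ x → choices x (2 ∷ []) ≈ Q x
    choices-2 x = trans (+-identityʳ _) (trans (reflexive (≡.cong (λ k → q ^ (x ℕ.+ k)) (ℕₚ.+-identityʳ x))) (q^-homo x x))

    q^*2 : ∀ i → q ^ (i ℕ.* 2) ≈ Q i
    q^*2 i = trans (reflexive (≡.cong (q ^_) (≡.trans (ℕₚ.*-comm i 2) (≡.cong (i ℕ.+_) (ℕₚ.+-identityʳ i))))) (q^-homo i i)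

    module _ (j : ℕ) where

      private
        ms = multiplicities j

      Odd-1+*2 : ∀ i → Odd (suc (i ℕ.* 2))
      Odd-1+*2 i 2∣ with ∣m+n∣m⇒∣n (≡.subst (2 ∣_) (ℕₚ.+-comm 1 (i ℕ.* 2)) 2∣) (divides i ≡.refl)
      ... | divides zero ()
      ... | divides (suc _) ()

      *2≤ : ∀ {i k} → i ℕ.≤ k → i ℕ.* 2 ℕ.≤ 2 ℕ.* k
      *2≤ {i} {k} i≤k = ≡.subst (i ℕ.* 2 ℕ.≤_) (ℕₚ.*-comm k 2) (ℕₚ.*-monoˡ-≤ 2 i≤k)

      ≤*2 : ∀ {i k} → k ℕ.≤ i → 2 ℕ.* k ℕ.≤ i ℕ.* 2
      ≤*2 {i} {k} k≤i = ≡.subst (ℕ._≤ i ℕ.* 2) (ℕₚ.*-comm k 2) (ℕₚ.*-monoˡ-≤ 2 k≤i)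

      4j≡ : 4 ℕ.* j ≡ 2 ℕ.* (j ℕ.+ j)
      4j≡ = ≡.trans (ℕₚ.*-assoc 2 2 j) (≡.cong (λ k → 2 ℕ.* (j ℕ.+ k)) (ℕₚ.+-identityʳ j))

      -- Sizes are consumed in pairs: 2i+1 gives 1 + q^(2i+1), and 2i+2, taken twice, gives
      -- q^(4i+4). The exponents 4 + 8 + ... + 4i add up to 2i(i+1).
      gf-small : ∀ i → i ℕ.≤ j → gf ms (i ℕ.* 2) ≈ Q (i ℕ.* suc i) * oddFactor i
      gf-small zero    _   = solve 0 (con true := con true :* con true :* con true) refl
      gf-small (suc i) i<j = begin
        choices (suc i ℕ.* 2) (ms (suc i ℕ.* 2)) * (choices (suc (i ℕ.* 2)) (ms (suc (i ℕ.* 2))) * gf ms (i ℕ.* 2))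
          ≡⟨ ≡.cong₂ (λ a b → choices (suc i ℕ.* 2) a * (choices (suc (i ℕ.* 2)) b * gf ms (i ℕ.* 2)))
               (multiplicities-smallEven (divides (suc i) ≡.refl) (*2≤ i<j))
               (multiplicities-smallOdd (Odd-1+*2 i) (ℕₚ.≤-trans (ℕₚ.n≤1+n _) (*2≤ i<j))) ⟩
        choices (suc i ℕ.* 2) (2 ∷ []) * (choices (suc (i ℕ.* 2)) (0 ∷ 1 ∷ []) * gf ms (i ℕ.* 2))
          ≈⟨ *-cong (choices-2 (suc i ℕ.* 2)) (*-cong (trans (choices-01 (suc (i ℕ.* 2))) (+-congˡ (*-congˡ (q^*2 i)))) (gf-small i (ℕₚ.<⇒≤ i<j))) ⟩
        Q (suc i ℕ.* 2) * ((1# + u i) * (Q (i ℕ.* suc i) * oddFactor i))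
          ≈⟨ solve 4 (λ a b c d → a :* (b :* (c :* d)) := c :* a :* (d :* b)) refl _ _ _ _ ⟩
        Q (i ℕ.* suc i) * Q (suc i ℕ.* 2) * (oddFactor i * (1# + u i))
          ≈⟨ *-congʳ (trans (reflexive (≡.cong Q (solveℕ 1 (λ i → (conℕ 1 ⊕ i) ⊗ (conℕ 2 ⊕ i) ⊜ i ⊗ (conℕ 1 ⊕ i) ⊕ (conℕ 1 ⊕ i) ⊗ conℕ 2) ≡.refl i)))
               (Q-homo (i ℕ.* suc i) (suc i ℕ.* 2))) ⟨
        Q (suc i ℕ.* suc (suc i)) * oddFactor (suc i) ∎

      -- No size from 2j + 1 to 4j may occur, so each of these factors is 1.
      gf-middle : ∀ i → i ℕ.≤ j → gf ms ((j ℕ.+ i) ℕ.* 2) ≈ gf ms (j ℕ.* 2)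
      gf-middle zero    _   = reflexive (≡.cong (λ k → gf ms (k ℕ.* 2)) (ℕₚ.+-identityʳ j))
      gf-middle (suc i) i<j rewrite ℕₚ.+-suc j i = begin
        choices (suc k ℕ.* 2) (ms (suc k ℕ.* 2)) * (choices (suc (k ℕ.* 2)) (ms (suc (k ℕ.* 2))) * gf ms (k ℕ.* 2))
          ≡⟨ ≡.cong₂ (λ a b → choices (suc k ℕ.* 2) a * (choices (suc (k ℕ.* 2)) b * gf ms (k ℕ.* 2)))
               (multiplicities-middleEven (divides (suc k) ≡.refl) (ℕₚ.<-trans 2j< (ℕₚ.n<1+n _))
                 (≡.subst (suc k ℕ.* 2 ℕ.≤_) (≡.sym 4j≡) (*2≤ (ℕₚ.+-monoʳ-< j i<j))))
               (multiplicities-largeOdd (Odd-1+*2 k) 2j<) ⟩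
        choices (suc k ℕ.* 2) (0 ∷ []) * (choices (suc (k ℕ.* 2)) (0 ∷ []) * gf ms (k ℕ.* 2))
          ≈⟨ *-cong (choices-0 (suc k ℕ.* 2)) (*-cong (choices-0 (suc (k ℕ.* 2))) (gf-middle i (ℕₚ.<⇒≤ i<j))) ⟩
        1# * (1# * gf ms (j ℕ.* 2))
          ≈⟨ trans (*-identityˡ _) (*-identityˡ _) ⟩
        gf ms (j ℕ.* 2) ∎
        where
        k = j ℕ.+ i
        2j< : 2 ℕ.* j ℕ.< suc (k ℕ.* 2)
        2j< = s≤s (≤*2 (ℕₚ.m≤m+n j i))

      gf-large : ∀ i → gf ms ((j ℕ.+ j ℕ.+ i) ℕ.* 2) ≈ gf ms (j ℕ.* 2) * tail (j ℕ.+ j) i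
      gf-large zero    = trans (reflexive (≡.cong (λ k → gf ms (k ℕ.* 2)) (ℕₚ.+-identityʳ (j ℕ.+ j)))) (trans (gf-middle j ℕₚ.≤-refl) (sym (*-identityʳ _)))
      gf-large (suc i) rewrite ℕₚ.+-suc (j ℕ.+ j) i = begin
        choices (suc k ℕ.* 2) (ms (suc k ℕ.* 2)) * (choices (suc (k ℕ.* 2)) (ms (suc (k ℕ.* 2))) * gf ms (k ℕ.* 2))
          ≡⟨ ≡.cong₂ (λ a b → choices (suc k ℕ.* 2) a * (choices (suc (k ℕ.* 2)) b * gf ms (k ℕ.* 2)))
               (multiplicities-largeEven (divides (suc k) ≡.refl) (≡.subst (ℕ._< suc k ℕ.* 2) (≡.sym 4j≡) (s≤s (ℕₚ.m≤n⇒m≤1+n (≤*2 (ℕₚ.m≤m+n (j ℕ.+ j) i))))))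
               (multiplicities-largeOdd (Odd-1+*2 k) (s≤s (≤*2 (ℕₚ.≤-trans (ℕₚ.m≤m+n j j) (ℕₚ.m≤m+n (j ℕ.+ j) i))))) ⟩
        choices (suc k ℕ.* 2) (0 ∷ 1 ∷ []) * (choices (suc (k ℕ.* 2)) (0 ∷ []) * gf ms (k ℕ.* 2))
          ≈⟨ *-cong (trans (choices-01 (suc k ℕ.* 2)) (+-congˡ (q^*2 (suc k)))) (*-cong (choices-0 (suc (k ℕ.* 2))) (gf-large i)) ⟩
        (1# + Q (suc k)) * (1# * (gf ms (j ℕ.* 2) * tail (j ℕ.+ j) i))
          ≈⟨ solve 3 (λ a b c → a :* (con true :* (b :* c)) := b :* (c :* a)) refl _ _ _ ⟩
        gf ms (j ℕ.* 2) * (tail (j ℕ.+ j) i * (1# + Q (suc k))) ∎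
        where k = j ℕ.+ j ℕ.+ i

      gf-block : gf ms ((j ℕ.+ j ℕ.+ T) ℕ.* 2) ≈ summand j
      gf-block = trans (gf-large T) (*-congʳ (gf-small j ℕₚ.≤-refl))

open import Data.Nat using (_+_; _*_; _%_; _≤_; _<_; _≡ᵇ_; _≟_)
open import Data.Nat.Properties
open import Data.Nat.ListAction using (sum)
open import Data.Integer using (ℤ; +_; -[1+_]; -_) renaming (_+_ to _+ℤ_; _*_ to _*ℤ_)
import Data.Integer.Properties as ℤₚ
import Data.Integer.Solver
open import Data.List using (_++_; map; replicate; filter; length)
open import Data.List.Membership.Propositional using (_∈_)
open import Data.List.Relation.Unary.Unique.Propositional using (Unique)
open import Data.Product using (_×_; _,_; Σ; ∃-syntax)
open import Data.Sum using (_⊎_; inj₁; inj₂; [_,_]′)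
open import Function using (_∘_)
open import Function.Bundles using (_⇔_)
open import Relation.Nullary using (¬_; contradiction)
open import Relation.Nullary.Decidable using (dec-true; dec-false)
open import Relation.Binary using (tri<; tri≈; tri>)
open import Relation.Binary.PropositionalEquality using (_≢_; _≗_; refl; sym; trans; cong; cong₂; subst; module ≡-Reasoning)

-- Power series over 𝔽₂ and the concrete truncated ring

Series : Set
Series = ℕ → Bool

0ₛ : Series
0ₛ _ = false

1ₛ : Series
1ₛ zero    = true
1ₛ (suc _) = false

_⊕_ : Series → Series → Series
(f ⊕ g) n = f n xor g n

shift : Series → Series
shift f zero    = false
shift f (suc n) = f n

infixl 6 _⊞_
infixl 7 _⊠_

-- Unnormalised expressions, read by `act` as operators on series. Products are compositions, so
-- associativity and the unit laws hold by computation; commutativity takes an argument.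
data Polynomial : Set where
  𝟘 𝟙 X   : Polynomial
  _⊞_ _⊠_ : Polynomial → Polynomial → Polynomial

act : Polynomial → Series → Series
act 𝟘       f = 0ₛ
act 𝟙       f = f
act X       f = shift f
act (a ⊞ b) f = act a f ⊕ act b f
act (a ⊠ b) f = act a (act b f)

-- Operators built from `X` move coefficients only upwards. This makes multiplication in
-- `truncatedRing` respect its equality.
act-cong : ∀ a {f g : Series} N → (∀ n → n < N → f n ≡ g n) → ∀ n → n < N → act a f n ≡ act a g n
act-cong 𝟘       N f≡g n n<N = refl
act-cong 𝟙       N f≡g n n<N = f≡g n n<N
act-cong X       N f≡g zero    n<N = refl
act-cong X       N f≡g (suc n) n<N = f≡g n (<-trans (n<1+n n) n<N)
act-cong (a ⊞ b) N f≡g n n<N = cong₂ _xor_ (act-cong a N f≡g n n<N) (act-cong b N f≡g n n<N)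
act-cong (a ⊠ b) N f≡g = act-cong a N (act-cong b N f≡g)

act-cong-≗ : ∀ a {f g : Series} → f ≗ g → act a f ≗ act a g
act-cong-≗ a f≗g n = act-cong a (suc n) (λ k _ → f≗g k) n ≤-refl

xor-interchange : ∀ a b c d → (a xor b) xor (c xor d) ≡ (a xor c) xor (b xor d)
xor-interchange a b c d = begin
  (a xor b) xor (c xor d)  ≡⟨ 𝔹.xor-assoc a b _ ⟩
  a xor (b xor (c xor d))  ≡⟨ cong (a xor_) (𝔹.xor-assoc b c d) ⟨
  a xor ((b xor c) xor d)  ≡⟨ cong (λ e → a xor (e xor d)) (𝔹.xor-comm b c) ⟩
  a xor ((c xor b) xor d)  ≡⟨ cong (a xor_) (𝔹.xor-assoc c b d) ⟩
  a xor (c xor (b xor d))  ≡⟨ 𝔹.xor-assoc a c _ ⟨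
  (a xor c) xor (b xor d)  ∎
  where open ≡-Reasoning

act-0ₛ : ∀ a → act a 0ₛ ≗ 0ₛ
act-0ₛ 𝟘       n       = refl
act-0ₛ 𝟙       n       = refl
act-0ₛ X       zero    = refl
act-0ₛ X       (suc n) = refl
act-0ₛ (a ⊞ b) n       = cong₂ _xor_ (act-0ₛ a n) (act-0ₛ b n)
act-0ₛ (a ⊠ b) n       = trans (act-cong-≗ a (act-0ₛ b) n) (act-0ₛ a n)

act-⊕ : ∀ a f g → act a (f ⊕ g) ≗ act a f ⊕ act a g
act-⊕ 𝟘       f g n       = refl
act-⊕ 𝟙       f g n       = refl
act-⊕ X       f g zero    = refl
act-⊕ X       f g (suc n) = refl
act-⊕ (a ⊞ b) f g n       = trans (cong₂ _xor_ (act-⊕ a f g n) (act-⊕ b f g n)) (xor-interchange (act a f n) _ _ _)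
act-⊕ (a ⊠ b) f g n       = trans (act-cong-≗ a (act-⊕ b f g) n) (act-⊕ a (act b f) (act b g) n)

act-shift : ∀ a f → act a (shift f) ≗ shift (act a f)
act-shift 𝟘       f zero    = refl
act-shift 𝟘       f (suc n) = refl
act-shift 𝟙       f n       = refl
act-shift X       f n       = refl
act-shift (a ⊞ b) f zero    = cong₂ _xor_ (act-shift a f 0) (act-shift b f 0)
act-shift (a ⊞ b) f (suc n) = cong₂ _xor_ (act-shift a f (suc n)) (act-shift b f (suc n))
act-shift (a ⊠ b) f n       = trans (act-cong-≗ a (act-shift b f) n) (act-shift a (act b f) n)

-- `X` is the only generator, so everything reduces to commuting with `shift` and to additivity.
act-comm : ∀ a b f → act a (act b f) ≗ act b (act a f)
act-comm 𝟘       b f n = sym (act-0ₛ b n)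
act-comm 𝟙       b f n = refl
act-comm X       b f n = sym (act-shift b f n)
act-comm (a ⊞ c) b f n = trans (cong₂ _xor_ (act-comm a b f n) (act-comm c b f n)) (sym (act-⊕ b (act a f) (act c f) n))
act-comm (a ⊠ c) b f n = trans (act-cong-≗ a (act-comm c b f) n) (act-comm a b (act c f) n)

-- 𝔽₂[X]/(X^T): polynomials act on power series, and two of them are equal
-- when their actions agree on the coefficients below T.
truncatedRing : ℕ → CommutativeRing 0ℓ 0ℓ
truncatedRing T = record
  { Carrier = Polynomial
  ; _≈_ = λ a b → ∀ f n → n < T → act a f n ≡ act b f n
  ; _+_ = _⊞_
  ; _*_ = _⊠_
  ; -_  = λ a → a
  ; 0#  = 𝟘
  ; 1#  = 𝟙
  ; isCommutativeRing = record
    { isRing = record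
      { +-isAbelianGroup = record
        { isGroup = record
          { isMonoid = record
            { isSemigroup = record
              { isMagma = record
                { isEquivalence = record
                  { refl  = λ f n _ → refl
                  ; sym   = λ a≈b f n n<T → sym (a≈b f n n<T)
                  ; trans = λ a≈b b≈c f n n<T → trans (a≈b f n n<T) (b≈c f n n<T)
                  }
                ; ∙-cong = λ a≈b c≈d f n n<T → cong₂ _xor_ (a≈b f n n<T) (c≈d f n n<T)
                }
              ; assoc = λ a b c f n _ → 𝔹.xor-assoc (act a f n) _ _
              }
            ; identity = (λ a f n _ → refl) , (λ a f n _ → 𝔹.xor-identityʳ _)
            }
          ; inverse = (λ a f n _ → 𝔹.xor-same (act a f n)) , (λ a f n _ → 𝔹.xor-same (act a f n))
          ; ⁻¹-cong = λ a≈b → a≈b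
          }
        ; comm = λ a b f n _ → 𝔹.xor-comm (act a f n) _
        }
      ; *-cong = λ {a} {b} {c} {d} a≈b c≈d f n n<T →
          trans (act-cong a T (c≈d f) n n<T) (a≈b (act d f) n n<T)
      ; *-assoc = λ a b c f n _ → refl
      ; *-identity = (λ a f n _ → refl) , (λ a f n _ → refl)
      ; distrib = (λ a b c f n _ → act-⊕ a (act b f) (act c f) n) , (λ a b c f n _ → refl)
      }
    ; *-comm = λ a b f n _ → act-comm a b f n
    }
  }

-- Counting lists modulo 2

count : List (List ℕ) → Series
count []      n = false
count (p ∷ P) n = (sum p ≡ᵇ n) xor count P n

count-++ : ∀ P P′ → count (P ++ P′) ≗ count P ⊕ count P′
count-++ []      P′ n = refl
count-++ (p ∷ P) P′ n = trans (cong ((sum p ≡ᵇ n) xor_) (count-++ P P′ n)) (sym (𝔹.xor-assoc (sum p ≡ᵇ n) _ _))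

odd : ℕ → Bool
odd zero    = false
odd (suc n) = not (odd n)

odd-%2 : ∀ n → (odd n ≡ true → n % 2 ≡ 1) × (odd n ≡ false → n % 2 ≡ 0)
odd-%2 zero          = (λ ()) , λ _ → refl
odd-%2 (suc zero)    = (λ _ → refl) , λ ()
odd-%2 (suc (suc n)) rewrite 𝔹.not-involutive (odd n) = odd-%2 n

odd-length-filter : ∀ P n → odd (length (filter (λ p → sum p ≟ n) P)) ≡ count P n
odd-length-filter []      n = refl
-- The test `≟` computes through `≡ᵇ`, so this abstraction also lets `filter` reduce.
odd-length-filter (p ∷ P) n with sum p ≡ᵇ n
... | true  = cong not (odd-length-filter P n)
... | false = odd-length-filter P n

sum-replicate-++ : ∀ m x p → sum (replicate m x ++ p) ≡ m * x + sum p
sum-replicate-++ zero    x p = refl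
sum-replicate-++ (suc m) x p = trans (cong (λ s → x + s) (sum-replicate-++ m x p)) (sym (+-assoc x (m * x) (sum p)))

module Count (n : ℕ) where

  open CommutativeRing (truncatedRing (suc n)) using (semiring)
  open Algebra.Properties.Semiring.Exp semiring using (_^_)

  -- The function `s ≡ᵇ_` is the series of the monomial X^s.
  act-X^ : ∀ k s → act (X ^ k) (s ≡ᵇ_) ≗ (k + s ≡ᵇ_)
  act-X^ zero    s m       = refl
  act-X^ (suc k) s zero    = refl
  act-X^ (suc k) s (suc m) = act-X^ k s m

  coefficient-X^ : ∀ k → act (X ^ k) 1ₛ ≗ (k ≡ᵇ_)
  coefficient-X^ k m = trans (act-cong-≗ (X ^ k) (λ { zero → refl ; (suc _) → refl }) m)
    (trans (act-X^ k 0 m) (cong (_≡ᵇ m) (+-identityʳ k)))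

  X^T≈0 : ∀ T f m → m < T → act (X ^ T) f m ≡ false
  X^T≈0 (suc T) f zero    _         = refl
  X^T≈0 (suc T) f (suc m) (s≤s m<T) = X^T≈0 T f m m<T

  -- With T = n + 1 the coefficient at n is the last one that survives, and it is the only one
  -- needed.
  open Truncated (truncatedRing (suc n)) (λ f m _ → 𝔹.xor-same (f m)) X n (X^T≈0 (suc n))
  open Bailey

  count-replicate : ∀ m x P → count (map (replicate m x ++_) P) ≗ act (X ^ (m * x)) (count P)
  count-replicate m x []      k = sym (act-0ₛ (X ^ (m * x)) k)
  count-replicate m x (p ∷ P) k = begin
    (sum (replicate m x ++ p) ≡ᵇ k) xor count (map (replicate m x ++_) P) k
      ≡⟨ cong₂ _xor_ (trans (cong (_≡ᵇ k) (sum-replicate-++ m x p)) (sym (act-X^ (m * x) (sum p) k))) (count-replicate m x P k) ⟩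
    act (X ^ (m * x)) (sum p ≡ᵇ_) k xor act (X ^ (m * x)) (count P) k
      ≡⟨ act-⊕ (X ^ (m * x)) (sum p ≡ᵇ_) (count P) k ⟨
    act (X ^ (m * x)) (count (p ∷ P)) k ∎
    where open ≡-Reasoning

  count-addParts : ∀ x ms P → count (addParts x ms P) ≗ act (choices x ms) (count P)
  count-addParts x []       P k = refl
  count-addParts x (m ∷ ms) P k = trans (count-++ (map (replicate m x ++_) P) _ k)
    (cong₂ _xor_ (count-replicate m x P k) (count-addParts x ms P k))

  -- `partitions` and `gf` recurse alike: `addParts` on lists is multiplication by `choices` on
  -- series.
  count-partitions : ∀ ms N → count (partitions ms N) ≗ act (gf ms N) 1ₛ
  count-partitions ms zero    zero    = refl
  count-partitions ms zero    (suc k) = refl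
  count-partitions ms (suc N) k = trans (count-addParts (suc N) (ms (suc N)) (partitions ms N) k)
    (act-cong-≗ (choices (suc N) (ms (suc N))) (count-partitions ms N) k)

  count-blocks : ∀ k → count (blocks n k) n ≡ act (∑ k summand) 1ₛ n
  count-blocks zero    = refl
  count-blocks (suc k) = trans (count-++ (blocks n k) (block n k) n)
    (cong₂ _xor_ (count-blocks k) (trans (count-partitions (multiplicities k) (bound n k) n) (gf-block k 1ₛ n ≤-refl)))

  xorSum : ℕ → (ℕ → Bool) → Bool
  xorSum zero    b = false
  xorSum (suc k) b = xorSum k b xor b k

  thetaCoefficient : ℕ → Bool
  thetaCoefficient r = (lower r ≡ᵇ n) xor (upper r ≡ᵇ n)

  coefficient-theta : ∀ k → act (∑ k (λ r → X ^ lower r ⊞ X ^ upper r)) 1ₛ n ≡ xorSum k thetaCoefficient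
  coefficient-theta zero    = refl
  coefficient-theta (suc k) = cong₂ _xor_ (coefficient-theta k)
    (cong₂ _xor_ (coefficient-X^ (lower k) n) (coefficient-X^ (upper k) n))

  odd-c4 : odd (length (c4-partitions n)) ≡ xorSum (suc n) thetaCoefficient
  odd-c4 = trans (odd-length-filter (blocks n (suc n)) n) (trans (count-blocks (suc n))
    -- Applying the operators to `1ₛ` reads off their coefficients.
    (trans (theta 1ₛ n ≤-refl) (coefficient-theta (suc n))))

  xorSum-false : ∀ k {b} → (∀ i → i < k → b i ≡ false) → xorSum k b ≡ false
  xorSum-false zero    b≡ = refl
  xorSum-false (suc k) b≡ = cong₂ _xor_ (xorSum-false k λ i i<k → b≡ i (m<n⇒m<1+n i<k)) (b≡ k ≤-refl)

  xorSum-single : ∀ {k r b} → r < k → b r ≡ true → (∀ i → i ≢ r → b i ≡ false) → xorSum k b ≡ true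
  xorSum-single {suc k} {r} r<1+k br b≡ with r ≟ k
  ... | yes refl = cong₂ _xor_ (xorSum-false k λ i i<k → b≡ i (<⇒≢ i<k)) br
  ... | no r≢k   = cong₂ _xor_ (xorSum-single (≤∧≢⇒< (≤-pred r<1+k) r≢k) br b≡) (b≡ k (r≢k ∘ sym))

-- Order and values of the exponents (7j² + 3j)/2

lower<upper : ∀ r → lower r < upper r
lower<upper r = m<m+n (lower r) (s≤s z≤n)

-- The difference is 3 + 3r. Together with `lower<upper` this gives the chain lower 0 < upper 0 <
-- lower 1 < upper 1 < ..., so no two integers j share an exponent.
upper<lower-suc : ∀ r → upper r < lower (suc r)
upper<lower-suc r = subst (upper r <_)
  (solve 2 (λ p r → p :+ (r :* (con 1 :+ r) :+ r :* (con 1 :+ r)) :+ (con 2 :+ r :* con 4) :+ (con 3 :+ con 3 :* r) :=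
    p :+ (con 1 :+ con 3 :* r) :+ ((con 1 :+ r) :* (con 2 :+ r) :+ (con 1 :+ r) :* (con 2 :+ r))) refl (pent r) r)
  (m<m+n (upper r) (s≤s z≤n))
  where open +-*-Solver

upper<lower : ∀ {i r} → i < r → upper i < lower r
upper<lower {i} {suc r} i<1+r with i ≟ r
... | yes refl = upper<lower-suc r
... | no i≢r   = <-trans (upper<lower (≤∧≢⇒< (≤-pred i<1+r) i≢r)) (<-trans (lower<upper r) (upper<lower-suc r))

-- Ensures that an index r whose exponent equals n lies in the range of the sum in `odd-c4`.
r≤lower : ∀ r → r ≤ lower r
r≤lower r = ≤-trans (m≤m*n r (suc r)) (≤-trans (m≤m+n (r * suc r) (r * suc r)) (m≤n+m _ (pent r)))

2*lower : ∀ r → 2 * lower r ≡ 7 * r * r + 3 * r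
-- The added r completes 2 `pent r` to the left side of `pent-square`.
2*lower r = +-cancelˡ-≡ r _ _ (begin
  r + 2 * lower r
    ≡⟨ solve 2 (λ p r → r :+ con 2 :* (p :+ (r :* (con 1 :+ r) :+ r :* (con 1 :+ r))) := con 2 :* p :+ r :+ con 4 :* (r :* (con 1 :+ r))) refl (pent r) r ⟩
  2 * pent r + r + 4 * (r * suc r)
    ≡⟨ cong (_+ 4 * (r * suc r)) (pent-square r) ⟩
  3 * (r * r) + 4 * (r * suc r)
    ≡⟨ solve 1 (λ r → con 3 :* (r :* r) :+ con 4 :* (r :* (con 1 :+ r)) := r :+ (con 7 :* r :* r :+ con 3 :* r)) refl r ⟩
  r + (7 * r * r + 3 * r) ∎)
  where
  open ≡-Reasoning
  open +-*-Solver

-- The value of 7j² + 3j at j = -r-1, with the negative term moved across to stay within ℕ.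
2*upper : ∀ r → 2 * upper r + 3 * suc r ≡ 7 * suc r * suc r
2*upper r = begin
  2 * upper r + 3 * suc r
    ≡⟨ cong (_+ 3 * suc r) (*-distribˡ-+ 2 (lower r) _) ⟩
  2 * lower r + 2 * (2 + r * 4) + 3 * suc r
    ≡⟨ cong (λ k → k + 2 * (2 + r * 4) + 3 * suc r) (2*lower r) ⟩
  7 * r * r + 3 * r + 2 * (2 + r * 4) + 3 * suc r
    ≡⟨ solve 1 (λ r → con 7 :* r :* r :+ con 3 :* r :+ con 2 :* (con 2 :+ r :* con 4) :+ con 3 :* (con 1 :+ r) := con 7 :* (con 1 :+ r) :* (con 1 :+ r)) refl r ⟩
  7 * suc r * suc r ∎
  where
  open ≡-Reasoning
  open +-*-Solver

value : ℤ → ℤ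
value j = (+ 7 *ℤ j *ℤ j) +ℤ (+ 3 *ℤ j)

value-lower : ∀ r → value (+ r) ≡ + (2 * lower r)
value-lower r = sym (trans (cong +_ (2*lower r)) (cong₂ _+ℤ_
  (trans (ℤₚ.pos-* (7 * r) r) (cong (_*ℤ + r) (ℤₚ.pos-* 7 r))) (ℤₚ.pos-* 3 r)))

value-upper : ∀ r → value -[1+ r ] ≡ + (2 * upper r)
value-upper r = begin
  (+ 7 *ℤ - s *ℤ - s) +ℤ (+ 3 *ℤ - s)
    ≡⟨ solve 1 (λ s → con (+ 7) :* (:- s) :* (:- s) :+ con (+ 3) :* (:- s) := con (+ 7) :* s :* s :- con (+ 3) :* s) refl s ⟩
  (+ 7 *ℤ s *ℤ s) +ℤ - (+ 3 *ℤ s)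
    ≡⟨ cong (_+ℤ - (+ 3 *ℤ s)) (trans (cong (_*ℤ s) (sym (ℤₚ.pos-* 7 (suc r)))) (trans (sym (ℤₚ.pos-* (7 * suc r) (suc r))) (cong +_ (sym (2*upper r))))) ⟩
  + (2 * upper r) +ℤ + (3 * suc r) +ℤ - (+ 3 *ℤ s)
    ≡⟨ cong (λ k → + (2 * upper r) +ℤ k +ℤ - (+ 3 *ℤ s)) (ℤₚ.pos-* 3 (suc r)) ⟩
  + (2 * upper r) +ℤ + 3 *ℤ s +ℤ - (+ 3 *ℤ s)
    ≡⟨ solve 2 (λ a b → a :+ b :- b := a) refl (+ (2 * upper r)) (+ 3 *ℤ s) ⟩
  + (2 * upper r) ∎
  where
  open ≡-Reasoning
  open Data.Integer.Solver.+-*-Solver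
  s = + suc r

-- Parity of the number of partitions

module _ (n : ℕ) where

  open Count n

  thetaCoefficient-false : ∀ i → lower i ≢ n → upper i ≢ n → thetaCoefficient i ≡ false
  thetaCoefficient-false i l≢ u≢ = cong₂ _xor_ (dec-false (lower i ≟ n) l≢) (dec-false (upper i ≟ n) u≢)

  -- Because the exponents form a strict chain, exactly one of them equals n, so exactly one
  -- coefficient in the sum is `true`.
  odd-c4-if : ∀ r → lower r ≡ n ⊎ upper r ≡ n → odd (length (c4-partitions n)) ≡ true
  odd-c4-if r hit = trans odd-c4 (xorSum-single (s≤s (≤-trans (r≤lower r) lower≤n)) (at-r hit) away)
    where
    lower≤n : lower r ≤ n
    lower≤n = [ ≤-reflexive , (λ u≡ → ≤-trans (<⇒≤ (lower<upper r)) (≤-reflexive u≡)) ]′ hit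
    n≤upper : n ≤ upper r
    n≤upper = [ (λ l≡ → ≤-trans (≤-reflexive (sym l≡)) (<⇒≤ (lower<upper r))) , (λ u≡ → ≤-reflexive (sym u≡)) ]′ hit
    at-r : lower r ≡ n ⊎ upper r ≡ n → thetaCoefficient r ≡ true
    at-r (inj₁ l≡) = cong₂ _xor_ (dec-true (lower r ≟ n) l≡) (dec-false (upper r ≟ n) λ u≡ → <⇒≢ (lower<upper r) (trans l≡ (sym u≡)))
    at-r (inj₂ u≡) = cong₂ _xor_ (dec-false (lower r ≟ n) λ l≡ → <⇒≢ (lower<upper r) (trans l≡ (sym u≡))) (dec-true (upper r ≟ n) u≡)
    away : ∀ i → i ≢ r → thetaCoefficient i ≡ false
    away i i≢r with <-cmp i r
    ... | tri≈ _ i≡r _ = contradiction i≡r i≢r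
    ... | tri< i<r _ _ = let u<n = <-≤-trans (upper<lower i<r) lower≤n in
      thetaCoefficient-false i (<⇒≢ (<-trans (lower<upper i) u<n)) (<⇒≢ u<n)
    ... | tri> _ _ r<i = let n<l = ≤-<-trans n≤upper (upper<lower r<i) in
      thetaCoefficient-false i (>⇒≢ n<l) (>⇒≢ (<-trans n<l (lower<upper i)))

  odd-c4-unless : (∀ r → lower r ≢ n × upper r ≢ n) → odd (length (c4-partitions n)) ≡ false
  odd-c4-unless miss = trans odd-c4 (xorSum-false (suc n) λ i _ → let l≢ , u≢ = miss i in thetaCoefficient-false i l≢ u≢)

theorem5 : (n : ℕ) →
    Σ (List (List ℕ)) λ L →
    Unique L
    × (∀ p → (p ∈ L) ⇔ (IsPartition n p × C4 p))
    × ((∃[ j ] (+ (2 * n) ≡ (+ 7 *ℤ j *ℤ j) +ℤ (+ 3 *ℤ j))) → length L % 2 ≡ 1)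
    × (¬ (∃[ j ] (+ (2 * n) ≡ (+ 7 *ℤ j *ℤ j) +ℤ (+ 3 *ℤ j))) → length L % 2 ≡ 0)
theorem5 n = c4-partitions n , Unique-c4-partitions n , ∈-c4-partitions n , odd-if , even-unless
  where
  odd-if : ∃[ j ] (+ (2 * n) ≡ value j) → length (c4-partitions n) % 2 ≡ 1
  odd-if (j , eq) = let toOdd , _ = odd-%2 (length (c4-partitions n)) in toOdd (case j eq)
    where
    case : ∀ j → + (2 * n) ≡ value j → odd (length (c4-partitions n)) ≡ true
    case (+ r)    eq = odd-c4-if n r (inj₁ (*-cancelˡ-≡ _ _ 2 (sym (ℤₚ.+-injective (trans eq (value-lower r))))))
    case -[1+ r ] eq = odd-c4-if n r (inj₂ (*-cancelˡ-≡ _ _ 2 (sym (ℤₚ.+-injective (trans eq (value-upper r))))))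
  even-unless : ¬ (∃[ j ] (+ (2 * n) ≡ value j)) → length (c4-partitions n) % 2 ≡ 0
  even-unless ∄j = let _ , toEven = odd-%2 (length (c4-partitions n)) in toEven (odd-c4-unless n λ r →
    (λ { refl → ∄j (+ r , sym (value-lower r)) }) , (λ { refl → ∄j (-[1+ r ] , sym (value-upper r)) }))
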